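{- Let $G$ be a graph with no even hole and no sector wheel. Then $G$ admits a chordal cover, i.e. there exist sets $X_1, X_2 \subseteq V(G)$ with $X_1 \cup X_2 = V(G)$ such that the induced subgraphs $G[X_1]$ and $G[X_2]$ are both chordal.
   Context: All graphs are finite and simple. A hole is an induced cycle with at least four vertices; it is even if it has an even number of vertices. A graph is chordal if it contains no hole. A wheel $(H,w)$ in $G$ consists of a hole $H$ of $G$ and a vertex $w \in V(G)\setminus V(H)$ with at least three neighbors in $V(H)$. A wheel $(H,w)$ is universal if $w$ is adjacent to every vertex of $H$. A sector wheel is a wheel $(H,w)$ such that either it is universal or $N(w)\cap V(H)$ induces a path. "$G$ has no sector wheel" means no hole $H$ and vertex $w$ of $G$ form a sector wheel. -}

module Defs where

open import Data.Nat using (ℕ; zero; suc; _≤_; _+_)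
open import Data.Nat.Properties using ()
open import Data.Fin using (Fin; toℕ)
open import Data.Fin.Subset using (Subset; _∈_)
open import Data.Bool using (Bool; true; false)
open import Data.Product using (Σ; ∃; _×_; _,_)
open import Data.Sum using (_⊎_)
open import Relation.Nullary using (¬_)
open import Relation.Binary.PropositionalEquality using (_≡_; _≢_)
open import Function.Definitions using (Injective)

record Graph : Set where
  field
    n     : ℕ
    adj   : Fin n → Fin n → Bool
    sym   : ∀ u v → adj u v ≡ adj v u
    irrefl : ∀ u → adj u u ≡ false

open Graph public

Adj : (G : Graph) → Fin (n G) → Fin (n G) → Set
Adj G u v = adj G u v ≡ true

CycAdj : (k : ℕ) → Fin k → Fin k → Set
CycAdj k i j =
  (suc (toℕ i) ≡ toℕ j) ⊎ (suc (toℕ j) ≡ toℕ i)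
  ⊎ ((toℕ i ≡ 0) × (suc (toℕ j) ≡ k)) ⊎ ((toℕ j ≡ 0) × (suc (toℕ i) ≡ k))

PathAdj : (m : ℕ) → Fin m → Fin m → Set
PathAdj m i j = (suc (toℕ i) ≡ toℕ j) ⊎ (suc (toℕ j) ≡ toℕ i)

IsHole : (G : Graph) (k : ℕ) → (Fin k → Fin (n G)) → Set
IsHole G k v =
  (4 ≤ k) × Injective _≡_ _≡_ v
  × (∀ i j → Adj G (v i) (v j) → CycAdj k i j)
  × (∀ i j → CycAdj k i j → Adj G (v i) (v j))

data Even : ℕ → Set where
  even-zero : Even zero
  even-ss   : ∀ {m} → Even m → Even (suc (suc m))

HasEvenHole : Graph → Set
HasEvenHole G = Σ ℕ λ k → Σ (Fin k → Fin (n G)) λ v → IsHole G k v × Even k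

InducesPath : (G : Graph) → (Fin (n G) → Set) → Set
InducesPath G S =
  Σ ℕ λ m → Σ (Fin m → Fin (n G)) λ p →
    Injective _≡_ _≡_ p
    × (∀ i → S (p i))
    × (∀ u → S u → ∃ λ i → p i ≡ u)
    × (∀ i j → Adj G (p i) (p j) → PathAdj m i j)
    × (∀ i j → PathAdj m i j → Adj G (p i) (p j))

NbrsOnHole : (G : Graph) (k : ℕ) → (Fin k → Fin (n G)) → Fin (n G) → Fin (n G) → Set
NbrsOnHole G k v w u = (∃ λ i → v i ≡ u) × Adj G w u

IsWheel : (G : Graph) (k : ℕ) → (Fin k → Fin (n G)) → Fin (n G) → Set
IsWheel G k v w =
  IsHole G k v
  × (∀ i → v i ≢ w)
  × (Σ (Fin k) λ a → Σ (Fin k) λ b → Σ (Fin k) λ c →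
       (a ≢ b) × (a ≢ c) × (b ≢ c)
       × Adj G w (v a) × Adj G w (v b) × Adj G w (v c))

IsUniversal : (G : Graph) (k : ℕ) → (Fin k → Fin (n G)) → Fin (n G) → Set
IsUniversal G k v w = ∀ i → Adj G w (v i)

IsSectorWheel : (G : Graph) (k : ℕ) → (Fin k → Fin (n G)) → Fin (n G) → Set
IsSectorWheel G k v w =
  IsWheel G k v w × (IsUniversal G k v w ⊎ InducesPath G (NbrsOnHole G k v w))

HasSectorWheel : Graph → Set
HasSectorWheel G =
  Σ ℕ λ k → Σ (Fin k → Fin (n G)) λ v → Σ (Fin (n G)) λ w → IsSectorWheel G k v w

-- G[X] is chordal: G[X] has no hole.  Since G[X] is an induced subgraph,
-- the holes of G[X] are exactly the holes of G all of whose vertices lie in X.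
InducedChordal : (G : Graph) → Subset (n G) → Set
InducedChordal G X = ∀ k (v : Fin k → Fin (n G)) → (∀ i → v i ∈ X) → ¬ IsHole G k v

HasChordalCover : Graph → Set
HasChordalCover G =
  Σ (Subset (n G)) λ X₁ → Σ (Subset (n G)) λ X₂ →
    (∀ u → u ∈ X₁ ⊎ u ∈ X₂) × InducedChordal G X₁ × InducedChordal G X₂

{-# OPTIONS --safe #-}
module Submission where

-- Split each component into breadth-first levels and take for X₁ and X₂ the vertices on
-- even and on odd levels.  A hole contained in one class lies on a single level d + 1, and
-- the set W of vertices on level d seeing it dominates it; any two vertices of W are joined
-- by an induced path whose interior, on lower levels, sees nothing of the hole.  All parity
-- information comes from closing such a path, or a single vertex of W, with an arc of the
-- hole.  The key point (gap-edge) is that every gap between consecutive, nonadjacent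
-- neighbours of a vertex of W contains an edge of the hole that is exactly the
-- neighbourhood on the hole of some vertex of W.  Two different such edges would give an
-- even hole, so there is at most one gap, and hence every vertex of W sees a single vertex
-- or a single edge of the hole.  Parity then also excludes two vertices of W of the same
-- kind attached at nonadjacent vertices, which leaves no way to dominate the hole.

open import Defs
open import Data.Bool using (Bool; true; false)
import Data.Bool.Properties as Bool
open import Data.Empty using (⊥; ⊥-elim)
open import Data.Fin using (Fin; toℕ; fromℕ<) renaming (_≟_ to _≟ᶠ_)
open import Data.Fin.Properties using (toℕ<n; toℕ-injective; toℕ-fromℕ<; injective⇒≤; any?)
open import Data.Fin.Subset using (Subset; _∈_)
open import Data.Nat using (ℕ; zero; suc; _+_; _∸_; _≤_; _<_; z≤n; s≤s; parity; _≤?_; _<?_; NonZero)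
open import Data.Nat.DivMod using (_%_; _mod_; m%n<n; m<n⇒m%n≡m; [m+n]%n≡m%n; %-distribˡ-+)
open import Data.Nat.Properties hiding (_≟_)
open import Data.Parity using (Parity; 0ℙ; 1ℙ; _⁻¹) renaming (_+_ to _⊕_)
open import Data.Parity.Properties using (_≟_; suc-homo-⁻¹; +-homo-+; ⁻¹-selfInverse; p+p≡0ℙ; p≢p⁻¹)
  renaming (+-identityʳ to ⊕-identityʳ)
open import Data.Product using (Σ; ∃; _×_; _,_; proj₁; proj₂)
open import Data.Sum using (_⊎_; inj₁; inj₂; [_,_]′)
open import Data.Unit using (⊤; tt)
open import Data.Vec using (tabulate)
open import Data.Vec.Properties using (lookup⇒[]=; []=⇒lookup; lookup∘tabulate)
open import Function using (_∘_; id; case_of_)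
open import Relation.Nullary using (¬_; Dec; yes; no; does)
open import Relation.Nullary.Decidable using (¬?; _→-dec_; _⊎-dec_; _×-dec_; from-yes; decidable-stable; dec-true)
open import Relation.Binary.Definitions using (tri<; tri≈; tri>)
open import Relation.Binary.PropositionalEquality as ≡ using (_≡_; _≢_; refl; cong; subst; trans)

-- Sector wheels are excluded on more holes than the given one. A gap of `u` closes up with `u` to a
-- second hole. A vertex `w` of W that sees the first inner vertex of the gap either has a shorter
-- gap inside it, or meets the arc in one interval and is then close to being a sector wheel of the
-- second hole; the parity of the link between `u` and `w` settles what is left. Every cycle that is
-- closed uses at most one link, so it does not matter whether different links meet. In the parity
-- equations a distance along the unrolled hole is `parity a ⊕ parity b`, and going once around adds
-- 1 because the length is odd: this 1 is what makes two arcs contradict each other.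

parity-suc : ∀ n → parity (suc n) ≡ parity n ⁻¹
parity-suc n = ≡.sym (⁻¹-selfInverse (suc-homo-⁻¹ n))

parity-even : ∀ n → parity n ≡ 0ℙ → Even n
parity-even zero          _ = even-zero
parity-even (suc (suc n)) e = even-ss (parity-even n e)

parity-⊕-odd : ∀ x m → parity m ≡ 1ℙ → parity x ⊕ parity (x + m) ≡ 1ℙ
parity-⊕-odd x m e rewrite +-homo-+ x m | e with parity x
... | 0ℙ = refl
... | 1ℙ = refl

parity-⊕-suc : ∀ x → parity x ⊕ parity (suc x) ≡ 1ℙ
parity-⊕-suc x = trans (cong (λ y → parity x ⊕ parity y) (+-comm 1 x)) (parity-⊕-odd x 1 refl)

-- Identities and implications in finitely many parities are settled by evaluating this decision
-- procedure under `from-yes`; every `clash` below is such a truth table.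
∀ℙ? : {P : Parity → Set} → (∀ p → Dec (P p)) → Dec (∀ p → P p)
∀ℙ? P? with P? 0ℙ | P? 1ℙ
... | yes p | yes q = yes λ where
        0ℙ → p
        1ℙ → q
... | no ¬p | _     = no λ f → ¬p (f 0ℙ)
... | _     | no ¬q = no λ f → ¬q (f 1ℙ)

-- Bounded search over intervals.

None : (ℕ → Set) → ℕ → ℕ → Set
None P a b = ∀ {i} → a ≤ i → i < b → ¬ P i

module _ {P : ℕ → Set} (P? : ∀ i → Dec (P i)) where

  search : ∀ a b → (∃ λ i → a ≤ i × i < b × P i × None P a i) ⊎ None P a b
  search a zero = inj₂ λ _ ()
  search a (suc b) with search a b
  ... | inj₁ (i , a≤i , i<b , p , none) = inj₁ (i , a≤i , m<n⇒m<1+n i<b , p , none)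
  ... | inj₂ none with a ≤? b | P? b
  ...   | yes a≤b | yes p = inj₁ (b , a≤b , ≤-refl , p , none)
  ...   | no a≰b  | _     = inj₂ λ a≤i i<1+b → ⊥-elim (a≰b (≤-trans a≤i (≤-pred i<1+b)))
  ...   | _       | no ¬p = inj₂ λ a≤i i<1+b p → case m<1+n⇒m<n∨m≡n i<1+b of λ where
          (inj₁ i<b)  → none a≤i i<b p
          (inj₂ refl) → ¬p p

  first : ∀ {a b} → a ≤ b → P b → ∃ λ i → a ≤ i × i ≤ b × P i × None P a i
  first {a} {b} a≤b p with search a b
  ... | inj₁ (i , a≤i , i<b , q , none) = i , a≤i , <⇒≤ i<b , q , none
  ... | inj₂ none                       = b , a≤b , ≤-refl , p , none

  last : ∀ {a b} → a ≤ b → P a → ∃ λ i → a ≤ i × i ≤ b × P i × None P (suc i) (suc b)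
  last {a} {b} a≤b p with P? b
  ... | yes q = b , a≤b , ≤-refl , q , λ b<i i<1+b → ⊥-elim (<⇒≱ b<i (≤-pred i<1+b))
  last {.0} {zero} z≤n p | no ¬q = ⊥-elim (¬q p)
  last {a} {suc b} a≤b p | no ¬q with m≤n⇒m<n∨m≡n a≤b
  ... | inj₂ refl = ⊥-elim (¬q p)
  ... | inj₁ a<1+b with last (≤-pred a<1+b) p
  ...   | i , a≤i , i≤b , q , none = i , a≤i , m≤n⇒m≤1+n i≤b , q , λ i<j j<2+b r →
          case m<1+n⇒m<n∨m≡n j<2+b of λ where
            (inj₁ j<1+b) → none i<j j<1+b r
            (inj₂ refl)  → ¬q r

first-min : ∀ {n} {P : Fin n → Set} → (∀ i → Dec (P i)) → ∃ P →
            ∃ λ i → P i × (∀ j → toℕ j < toℕ i → ¬ P j)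
first-min {suc n} P? (i , p) with P? Fin.zero
... | yes q = Fin.zero , q , λ _ ()
first-min {suc n} P? (Fin.zero  , p) | no ¬q = ⊥-elim (¬q p)
first-min {suc n} P? (Fin.suc i , p) | no ¬q with first-min (P? ∘ Fin.suc) (i , p)
... | j , r , least = Fin.suc j , r , λ where
      Fin.zero    _         → ¬q
      (Fin.suc l) (s≤s l<j) → least l l<j

-- Counting marked positions modulo 2.

bit : Bool → Parity
bit true  = 1ℙ
bit false = 0ℙ

total : (ℕ → Parity) → ℕ → Parity
total χ zero    = 0ℙ
total χ (suc i) = total χ i ⊕ χ i

total-⊕ : ∀ χ ψ i → total (λ l → χ l ⊕ ψ l) i ≡ total χ i ⊕ total ψ i
total-⊕ χ ψ zero    = refl
total-⊕ χ ψ (suc i) rewrite total-⊕ χ ψ i =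
  interchange (total χ i) (total ψ i) (χ i) (ψ i)
  where
  interchange : ∀ p q r s → p ⊕ q ⊕ (r ⊕ s) ≡ p ⊕ r ⊕ (q ⊕ s)
  interchange = from-yes (∀ℙ? λ p → ∀ℙ? λ q → ∀ℙ? λ r → ∀ℙ? λ s →
    p ⊕ q ⊕ (r ⊕ s) ≟ p ⊕ r ⊕ (q ⊕ s))

OddGaps : (ℕ → Parity) → ℕ → ℕ → Set
OddGaps χ a b = ∀ {i j} → a ≤ i → i < j → j ≤ b → χ i ≡ 1ℙ → χ j ≡ 1ℙ →
  None (λ l → χ l ≡ 1ℙ) (suc i) j → parity i ⊕ parity j ≡ 1ℙ

-- Each step from a mark to the next has odd length and accounts for one mark, so the half-open
-- interval from `a` to `b` has as many marks, modulo 2, as positions.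
total-odd-gaps : ∀ χ {a b} → a ≤ b → χ a ≡ 1ℙ → χ b ≡ 1ℙ → OddGaps χ a b →
                 total χ a ⊕ total χ b ≡ parity a ⊕ parity b
total-odd-gaps χ {a} {b} a≤b χa χb odd = finish (upto b a≤b ≤-refl)
  where
  -- Here `i` is the last mark up to `c`. Counted through `c` itself, hence the summand `χ c`, the
  -- marks number `i - a + 1` modulo 2.
  Upto : ℕ → Set
  Upto c = ∃ λ i → a ≤ i × i ≤ c × χ i ≡ 1ℙ × None (λ l → χ l ≡ 1ℙ) (suc i) (suc c) ×
    total χ a ⊕ (total χ c ⊕ χ c) ≡ parity a ⊕ parity i ⊕ 1ℙ
  base : Upto a
  base = a , ≤-refl , ≤-refl , χa , (λ a<i i<1+a → ⊥-elim (<⇒≱ a<i (≤-pred i<1+a))) ,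
    double (total χ a) (χ a) (parity a) χa
    where
    double : ∀ p q r → q ≡ 1ℙ → p ⊕ (p ⊕ q) ≡ r ⊕ r ⊕ 1ℙ
    double = from-yes (∀ℙ? λ p → ∀ℙ? λ q → ∀ℙ? λ r →
      (q ≟ 1ℙ) →-dec (p ⊕ (p ⊕ q) ≟ r ⊕ r ⊕ 1ℙ))
  next : ∀ {c} → suc c ≤ b → Upto c → Upto (suc c)
  next {c} c<b (i , a≤i , i≤c , χi , none , e) with χ (suc c) in eq
  ... | 1ℙ = suc c , ≤-trans a≤i (m≤n⇒m≤1+n i≤c) , ≤-refl , eq ,
    (λ c<i i<1+c → ⊥-elim (<⇒≱ c<i (≤-pred i<1+c))) ,
    flip (total χ a) (total χ c ⊕ χ c) (parity a) (parity i) (parity (suc c))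
      (odd a≤i (s≤s i≤c) c<b χi eq none) e
    where
    flip : ∀ p q r s t → s ⊕ t ≡ 1ℙ → p ⊕ q ≡ r ⊕ s ⊕ 1ℙ → p ⊕ (q ⊕ 1ℙ) ≡ r ⊕ t ⊕ 1ℙ
    flip = from-yes (∀ℙ? λ p → ∀ℙ? λ q → ∀ℙ? λ r → ∀ℙ? λ s → ∀ℙ? λ t →
      (s ⊕ t ≟ 1ℙ) →-dec (p ⊕ q ≟ r ⊕ s ⊕ 1ℙ) →-dec (p ⊕ (q ⊕ 1ℙ) ≟ r ⊕ t ⊕ 1ℙ))
  ... | 0ℙ = i , a≤i , m≤n⇒m≤1+n i≤c , χi , extend ,
    trans (cong (total χ a ⊕_) (⊕-identityʳ (total χ c ⊕ χ c))) e
    where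
    extend : None (λ l → χ l ≡ 1ℙ) (suc i) (suc (suc c))
    extend i<l l<2+c m with m<1+n⇒m<n∨m≡n l<2+c
    ... | inj₁ l<1+c = none i<l l<1+c m
    ... | inj₂ refl  = case trans (≡.sym eq) m of λ ()
  upto : ∀ c → a ≤ c → c ≤ b → Upto c
  upto zero    z≤n   _     = base
  upto (suc c) a≤1+c 1+c≤b with m≤n⇒m<n∨m≡n a≤1+c
  ... | inj₁ a<1+c = next 1+c≤b (upto c (≤-pred a<1+c) (≤-trans (n≤1+n c) 1+c≤b))
  ... | inj₂ refl  = base
  finish : Upto b → total χ a ⊕ total χ b ≡ parity a ⊕ parity b
  finish (i , a≤i , i≤b , χi , none , e) with m≤n⇒m<n∨m≡n i≤b
  ... | inj₁ i<b  = ⊥-elim (none i<b ≤-refl χb)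
  ... | inj₂ refl = drop (total χ a) (total χ b) (χ b) (parity a ⊕ parity b) χb e
    where
    drop : ∀ p q r s → r ≡ 1ℙ → p ⊕ (q ⊕ r) ≡ s ⊕ 1ℙ → p ⊕ q ≡ s
    drop = from-yes (∀ℙ? λ p → ∀ℙ? λ q → ∀ℙ? λ r → ∀ℙ? λ s →
      (r ≟ 1ℙ) →-dec (p ⊕ (q ⊕ r) ≟ s ⊕ 1ℙ) →-dec (p ⊕ q ≟ s))

-- Residues after a step shorter than the modulus.

%-step : ∀ i {d k} .{{_ : NonZero k}} → d < k →
         (i % k + d < k × (i + d) % k ≡ i % k + d) ⊎
         (∃ λ s → k + s ≡ i % k + d × s < i % k × (i + d) % k ≡ s)
%-step i {d} {k} d<k with i % k + d <? k
... | yes r+d<k = inj₁ (r+d<k , trans split (m<n⇒m%n≡m r+d<k))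
  where
  split : (i + d) % k ≡ (i % k + d) % k
  split = trans (%-distribˡ-+ i d k) (cong (λ e → (i % k + e) % k) (m<n⇒m%n≡m d<k))
... | no r+d≮k with m≤n⇒∃[o]m+o≡n (≮⇒≥ r+d≮k)
...   | s , k+s≡r+d = inj₂ (s , k+s≡r+d , s<r , (begin-equality
        (i + d) % k         ≡⟨ %-distribˡ-+ i d k ⟩
        (i % k + d % k) % k ≡⟨ cong (λ e → (i % k + e) % k) (m<n⇒m%n≡m d<k) ⟩
        (i % k + d) % k     ≡⟨ cong (_% k) (≡.sym k+s≡r+d) ⟩
        (k + s) % k         ≡⟨ cong (_% k) (+-comm k s) ⟩
        (s + k) % k         ≡⟨ [m+n]%n≡m%n s k ⟩
        s % k               ≡⟨ m<n⇒m%n≡m (<-trans s<r (m%n<n i k)) ⟩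
        s                   ∎))
  where
  open ≤-Reasoning
  s<r : s < i % k
  s<r = +-cancelˡ-< k s (i % k)
    (subst (_< k + i % k) (≡.sym k+s≡r+d) (subst (i % k + d <_) (+-comm (i % k) k) (+-monoʳ-< (i % k) d<k)))

toℕ-mod : ∀ i k .{{_ : NonZero k}} → toℕ (i mod k) ≡ i % k
toℕ-mod i k = toℕ-fromℕ< (m%n<n i k)

-- Induced paths and holes

module _ {V : Set} where

  join : ℕ → (ℕ → V) → (ℕ → V) → ℕ → V
  join m       f g zero    = f 0
  join zero    f g (suc i) = g i
  join (suc m) f g (suc i) = join m (f ∘ suc) g i

  join-left : ∀ {m f g i} → i ≤ m → join m f g i ≡ f i
  join-left {zero}  z≤n       = refl
  join-left {suc m} z≤n       = refl
  join-left {suc m} (s≤s i≤m) = join-left i≤m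

  join-right : ∀ m {f g} j → join m f g (suc m + j) ≡ g j
  join-right zero    j = refl
  join-right (suc m) j = join-right m j

  infixr 5 _◂_
  _◂_ : V → (ℕ → V) → ℕ → V
  (x ◂ f) zero    = x
  (x ◂ f) (suc i) = f i

data Side (m p : ℕ) : ℕ → Set where
  left  : ∀ {i} → i ≤ m → Side m p i
  right : ∀ j → j ≤ p → Side m p (suc m + j)

side : ∀ m p {i} → i < suc m + suc p → Side m p i
side m p {i} i<k with i ≤? m
... | yes i≤m = left i≤m
... | no i≰m with m≤n⇒∃[o]m+o≡n (≰⇒> i≰m)
...   | j , refl = right j (≤-pred (+-cancelˡ-< (suc m) j (suc p) i<k))

module Paths (G : Graph) where

  private
    V : Set
    V = Fin (n G)

  infix 4 _~_ _~?_
  _~_ : V → V → Set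
  _~_ = Adj G

  _~?_ : ∀ u v → Dec (u ~ v)
  u ~? v = adj G u v Bool.≟ true

  ~-sym : ∀ {u v} → u ~ v → v ~ u
  ~-sym {u} {v} u~v = trans (Graph.sym G v u) u~v

  ~⇒≢ : ∀ {u v} → u ~ v → u ≢ v
  ~⇒≢ {u} u~u refl with trans (≡.sym u~u) (irrefl G u)
  ... | ()

  -- Paths and holes are sequences of which only an initial segment matters.
  record Induced (m : ℕ) (f : ℕ → V) : Set where
    field
      distinct  : ∀ {i j} → i < j → j ≤ m → f i ≢ f j
      edge      : ∀ {i} → i < m → f i ~ f (suc i)
      chordless : ∀ {i j} → suc i < j → j ≤ m → ¬ f i ~ f j

  induced-point : ∀ {f} → Induced 0 f
  induced-point = record { distinct = λ { () z≤n } ; edge = λ () ; chordless = λ { () z≤n } }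

  induced-cons : ∀ {m x f} → Induced m f → x ~ f 0 → (∀ {i} → i ≤ m → x ≢ f i) →
                 (∀ {i} → 0 < i → i ≤ m → ¬ x ~ f i) → Induced (suc m) (x ◂ f)
  induced-cons {m} {x} {f} F x~f0 fresh apart = record
    { distinct = dist ; edge = edg ; chordless = chord }
    where
    module F = Induced F
    dist : ∀ {i j} → i < j → j ≤ suc m → (x ◂ f) i ≢ (x ◂ f) j
    dist {zero}  {suc j} _         (s≤s j≤m) = fresh j≤m
    dist {suc i} {suc j} (s≤s i<j) (s≤s j≤m) = F.distinct i<j j≤m
    edg : ∀ {i} → i < suc m → (x ◂ f) i ~ f i
    edg {zero}  _         = x~f0
    edg {suc i} (s≤s i<m) = F.edge i<m
    chord : ∀ {i j} → suc i < j → j ≤ suc m → ¬ (x ◂ f) i ~ (x ◂ f) j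
    chord {zero}  {suc j} (s≤s 0<j)   (s≤s j≤m) = apart 0<j j≤m
    chord {suc i} {suc j} (s≤s 1+i<j) (s≤s j≤m) = F.chordless 1+i<j j≤m

  record Hole (k : ℕ) (f : ℕ → V) : Set where
    field
      long      : 4 ≤ k
      distinct  : ∀ {i j} → i < j → j < k → f i ≢ f j
      edge      : ∀ {i} → suc i < k → f i ~ f (suc i)
      closing   : ∀ {l} → suc l ≡ k → f l ~ f 0
      chordless : ∀ {i j} → suc i < j → j < k → f i ~ f j → i ≡ 0 × suc j ≡ k

  isHole : ∀ {k f} → Hole k f → IsHole G k (f ∘ toℕ)
  isHole {k} {f} H = long , inj , to , from
    where
    open Hole H
    inj : ∀ {i j : Fin k} → f (toℕ i) ≡ f (toℕ j) → i ≡ j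
    inj {i} {j} e with <-cmp (toℕ i) (toℕ j)
    ... | tri< i<j _ _ = ⊥-elim (distinct i<j (toℕ<n j) e)
    ... | tri≈ _ i≡j _ = toℕ-injective i≡j
    ... | tri> _ _ j<i = ⊥-elim (distinct j<i (toℕ<n i) (≡.sym e))
    to : ∀ i j → f (toℕ i) ~ f (toℕ j) → CycAdj k i j
    to i j e with <-cmp (toℕ i) (toℕ j)
    ... | tri≈ _ i≡j _ = ⊥-elim (~⇒≢ e (cong f i≡j))
    to i j e | tri< i<j _ _ with m≤n⇒m<n∨m≡n i<j
    ... | inj₂ 1+i≡j = inj₁ 1+i≡j
    ... | inj₁ 1+i<j = inj₂ (inj₂ (inj₁ (chordless 1+i<j (toℕ<n j) e)))
    to i j e | tri> _ _ j<i with m≤n⇒m<n∨m≡n j<i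
    ... | inj₂ 1+j≡i = inj₂ (inj₁ 1+j≡i)
    ... | inj₁ 1+j<i = inj₂ (inj₂ (inj₂ (chordless 1+j<i (toℕ<n i) (~-sym e))))
    step : ∀ (i j : Fin k) → suc (toℕ i) ≡ toℕ j → f (toℕ i) ~ f (toℕ j)
    step i j e = subst (λ l → f (toℕ i) ~ f l) e (edge (subst (_< k) (≡.sym e) (toℕ<n j)))
    close : ∀ (i j : Fin k) → toℕ i ≡ 0 → suc (toℕ j) ≡ k → f (toℕ j) ~ f (toℕ i)
    close i j i≡0 e = subst (λ l → f (toℕ j) ~ f l) (≡.sym i≡0) (closing e)
    from : ∀ i j → CycAdj k i j → f (toℕ i) ~ f (toℕ j)
    from i j (inj₁ e)                      = step i j e
    from i j (inj₂ (inj₁ e))               = ~-sym (step j i e)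
    from i j (inj₂ (inj₂ (inj₁ (z , e)))) = ~-sym (close i j z e)
    from i j (inj₂ (inj₂ (inj₂ (z , e)))) = close j i z e

  joinHole : ∀ {m p f g} → Induced m f → Induced p g → 2 ≤ m + p →
             f m ~ g 0 → g p ~ f 0 →
             (∀ {i j} → i ≤ m → j ≤ p → f i ≢ g j) →
             (∀ {i j} → i ≤ m → j ≤ p → f i ~ g j → (i ≡ m × j ≡ 0) ⊎ (i ≡ 0 × j ≡ p)) →
             Hole (suc m + suc p) (join m f g)
  joinHole {m} {p} {f} {g} F Q 2≤m+p fm~g0 gp~f0 apart cross = record
    { long = subst (4 ≤_) (cong suc (≡.sym (+-suc m p))) (s≤s (s≤s 2≤m+p))
    ; distinct = λ i<j j<k e → dist (side m p (<-trans i<j j<k)) (side m p j<k) i<j e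
    ; edge = λ 1+i<k → edg (side m p (<-trans (n<1+n _) 1+i<k)) 1+i<k
    ; closing = λ where refl → cls
    ; chordless = λ 1+i<j j<k e →
        chord (side m p (<-trans (<-trans (n<1+n _) 1+i<j) j<k)) (side m p j<k) 1+i<j e }
    where
    module F = Induced F
    module Q = Induced Q
    h : ℕ → V
    h = join m f g
    L : ∀ {i} → i ≤ m → h i ≡ f i
    L = join-left
    R : ∀ j → h (suc m + j) ≡ g j
    R = join-right m
    dist : ∀ {i j} → Side m p i → Side m p j → i < j → h i ≢ h j
    dist (left a)  (left b)    i<j e = F.distinct i<j b (trans (≡.sym (L a)) (trans e (L b)))
    dist (left a)  (right j b) i<j e = apart a b (trans (≡.sym (L a)) (trans e (R j)))
    dist (right i a) (left b)  i<j e = <⇒≱ i<j (≤-trans b (≤-trans (n≤1+n m) (m≤m+n (suc m) i)))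
    dist (right i a) (right j b) i<j e =
      Q.distinct (+-cancelˡ-< (suc m) i j i<j) b (trans (≡.sym (R i)) (trans e (R j)))
    edg : ∀ {i} → Side m p i → suc i < suc m + suc p → h i ~ h (suc i)
    edg (left a) _ with m≤n⇒m<n∨m≡n a
    ... | inj₁ i<m  = ≡.subst₂ _~_ (≡.sym (L a)) (≡.sym (L i<m)) (F.edge i<m)
    ... | inj₂ refl = ≡.subst₂ _~_ (≡.sym (L a))
                        (≡.sym (trans (cong h (≡.sym (+-identityʳ (suc m)))) (R 0))) fm~g0
    edg (right i a) 1+i<k = ≡.subst₂ _~_ (≡.sym (R i))
      (≡.sym (trans (cong h (≡.sym (+-suc (suc m) i))) (R (suc i))))
      (Q.edge (≤-pred (+-cancelˡ-< (suc m) (suc i) (suc p)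
        (subst (_< suc m + suc p) (≡.sym (+-suc (suc m) i)) 1+i<k))))
    cls : h (m + suc p) ~ h 0
    cls = ≡.subst₂ _~_ (≡.sym (trans (cong h (+-suc m p)) (R p))) (≡.sym (L z≤n)) gp~f0
    chord : ∀ {i j} → Side m p i → Side m p j → suc i < j → h i ~ h j →
            i ≡ 0 × suc j ≡ suc m + suc p
    chord (left a) (left b) 1+i<j e =
      ⊥-elim (F.chordless 1+i<j b (≡.subst₂ _~_ (L a) (L b) e))
    chord (left a) (right j b) 1+i<j e with cross a b (≡.subst₂ _~_ (L a) (R j) e)
    ... | inj₁ (refl , refl) = ⊥-elim (<-irrefl (≡.sym (+-identityʳ (suc m))) 1+i<j)
    ... | inj₂ (refl , refl) = refl , cong suc (≡.sym (+-suc m p))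
    chord (right i a) (left b) 1+i<j e =
      ⊥-elim (<⇒≱ 1+i<j (≤-trans b (≤-trans (m≤m+n m i) (≤-trans (n≤1+n _) (n≤1+n _)))))
    chord (right i a) (right j b) 1+i<j e = ⊥-elim (Q.chordless
      (+-cancelˡ-< (suc m) (suc i) j (subst (_< suc m + j) (≡.sym (+-suc (suc m) i)) 1+i<j)) b
      (≡.subst₂ _~_ (R i) (R j) e))

  module EvenHoleFree (noEven : ¬ HasEvenHole G) where

    hole-odd : ∀ {k f} → Hole k f → parity k ≡ 1ℙ
    hole-odd {k} {f} H with parity k in e
    ... | 0ℙ = ⊥-elim (noEven (k , f ∘ toℕ , isHole H , parity-even k e))
    ... | 1ℙ = refl

    -- The cycle has `m + p + 2` vertices. With `m + p = 1` it is a triangle and not a hole, but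
    -- then the parity is odd anyway; absorbing this case spares later arguments the distinction.
    join-odd : ∀ {m p f g} → Induced m f → Induced p g → 1 ≤ m + p →
               f m ~ g 0 → g p ~ f 0 →
               (∀ {i j} → i ≤ m → j ≤ p → f i ≢ g j) →
               (∀ {i j} → i ≤ m → j ≤ p → f i ~ g j → (i ≡ m × j ≡ 0) ⊎ (i ≡ 0 × j ≡ p)) →
               parity (m + p) ≡ 1ℙ
    join-odd {m} {p} F Q 1≤m+p a b c d with m≤n⇒m<n∨m≡n 1≤m+p
    ... | inj₂ 1≡m+p = cong parity (≡.sym 1≡m+p)
    ... | inj₁ 2≤m+p = trans (cong (parity ∘ suc) (≡.sym (+-suc m p))) (hole-odd (joinHole F Q 2≤m+p a b c d))

  module SectorWheelFree (noSector : ¬ HasSectorWheel G) where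

    private
      on : ∀ {k l v} (f : ℕ → V) → l < k → f l ≡ v → Σ (Fin k) λ a → f (toℕ a) ≡ v
      on f l<k e = fromℕ< l<k , trans (cong f (toℕ-fromℕ< l<k)) e

    no-universal : ∀ {k f w} → Hole k f → (∀ {l} → l < k → w ~ f l) → ⊥
    no-universal {k} {f} {w} H uni = noSector (k , f ∘ toℕ , w ,
      (isHole H , (λ i e → ~⇒≢ (all i) (≡.sym e)) , idx 0<k , idx 1<k , idx 2<k ,
       differ 0<k 1<k (λ ()) , differ 0<k 2<k (λ ()) , differ 1<k 2<k (λ ()) ,
       all _ , all _ , all _) , inj₁ all)
      where
      all : ∀ (i : Fin k) → w ~ f (toℕ i)
      all i = uni (toℕ<n i)
      2<k : 2 < k
      2<k = <-trans (n<1+n 2) (Hole.long H)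
      1<k : 1 < k
      1<k = <-trans (n<1+n 1) 2<k
      0<k : 0 < k
      0<k = <-trans (n<1+n 0) 1<k
      idx : ∀ {l} → l < k → Fin k
      idx p = fromℕ< p
      differ : ∀ {l l′} (p : l < k) (q : l′ < k) → l ≢ l′ → idx p ≢ idx q
      differ p q l≢l′ e = l≢l′ (trans (≡.sym (toℕ-fromℕ< p)) (trans (cong toℕ e) (toℕ-fromℕ< q)))

    -- The path `q` has `M + 1` vertices, so `2 ≤ M` supplies the three neighbours of a wheel. The
    -- path need not follow the numbering of the hole, since it may run through the point where that
    -- numbering closes up.
    no-path-sector : ∀ {k f w M q} → Hole k f → (∀ {l} → l < k → f l ≢ w) →
                     Induced M q → 2 ≤ M →
                     (∀ {i} → i ≤ M → ∃ λ l → l < k × f l ≡ q i) →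
                     (∀ {i} → i ≤ M → w ~ q i) →
                     (∀ {l} → l < k → w ~ f l → ∃ λ i → i ≤ M × q i ≡ f l) → ⊥
    no-path-sector {k} {f} {w} {M} {q} H off Q 2≤M onHole nbr all =
      noSector (k , f ∘ toℕ , w ,
        (isHole H , (λ i → off (toℕ<n i)) , at z≤n , at 1≤M , at 2≤M ,
         differ z≤n 1≤M (s≤s z≤n) , differ z≤n 2≤M (s≤s z≤n) , differ 1≤M 2≤M ≤-refl ,
         adjAt z≤n , adjAt 1≤M , adjAt 2≤M) ,
        inj₂ (suc M , q ∘ toℕ , inj , mem , (λ u → λ where ((l , refl) , a) → hit l a) , to , from))
      where
      module Q = Induced Q
      1≤M : 1 ≤ M
      1≤M = ≤-trans (n≤1+n 1) 2≤M
      pos : ∀ {i} → i ≤ M → Σ (Fin k) λ a → f (toℕ a) ≡ q i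
      pos i≤M = let (l , l<k , e) = onHole i≤M in on f l<k e
      at : ∀ {i} → i ≤ M → Fin k
      at i≤M = proj₁ (pos i≤M)
      differ : ∀ {i j} (a : i ≤ M) (b : j ≤ M) → i < j → at a ≢ at b
      differ a b i<j e = Q.distinct i<j b
        (trans (≡.sym (proj₂ (pos a))) (trans (cong (f ∘ toℕ) e) (proj₂ (pos b))))
      adjAt : ∀ {i} (a : i ≤ M) → w ~ f (toℕ (at a))
      adjAt a = subst (w ~_) (≡.sym (proj₂ (pos a))) (nbr a)
      bound : ∀ (i : Fin (suc M)) → toℕ i ≤ M
      bound i = ≤-pred (toℕ<n i)
      inj : ∀ {i j : Fin (suc M)} → q (toℕ i) ≡ q (toℕ j) → i ≡ j
      inj {i} {j} e with <-cmp (toℕ i) (toℕ j)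
      ... | tri< i<j _ _ = ⊥-elim (Q.distinct i<j (bound j) e)
      ... | tri≈ _ i≡j _ = toℕ-injective i≡j
      ... | tri> _ _ j<i = ⊥-elim (Q.distinct j<i (bound i) (≡.sym e))
      mem : ∀ i → NbrsOnHole G k (f ∘ toℕ) w (q (toℕ i))
      mem i = pos (bound i) , nbr (bound i)
      hit : ∀ l → w ~ f (toℕ l) → ∃ λ i → q (toℕ i) ≡ f (toℕ l)
      hit l a with all (toℕ<n l) a
      ... | i , i≤M , e = on q (s≤s i≤M) e
      to : ∀ i j → q (toℕ i) ~ q (toℕ j) → PathAdj (suc M) i j
      to i j e with <-cmp (toℕ i) (toℕ j)
      ... | tri≈ _ i≡j _ = ⊥-elim (~⇒≢ e (cong q i≡j))
      to i j e | tri< i<j _ _ with m≤n⇒m<n∨m≡n i<j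
      ... | inj₂ 1+i≡j = inj₁ 1+i≡j
      ... | inj₁ 1+i<j = ⊥-elim (Q.chordless 1+i<j (bound j) e)
      to i j e | tri> _ _ j<i with m≤n⇒m<n∨m≡n j<i
      ... | inj₂ 1+j≡i = inj₂ 1+j≡i
      ... | inj₁ 1+j<i = ⊥-elim (Q.chordless 1+j<i (bound i) (~-sym e))
      step : ∀ (i j : Fin (suc M)) → suc (toℕ i) ≡ toℕ j → q (toℕ i) ~ q (toℕ j)
      step i j e = subst (λ l → q (toℕ i) ~ q l) e (Q.edge (subst (_≤ M) (≡.sym e) (bound j)))
      from : ∀ i j → PathAdj (suc M) i j → q (toℕ i) ~ q (toℕ j)
      from i j (inj₁ e) = step i j e
      from i j (inj₂ e) = ~-sym (step j i e)

-- Vertices attached to a hole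

module Core (G : Graph) (noEven : ¬ HasEvenHole G) (noSector : ¬ HasSectorWheel G) where

  open Paths G
  open EvenHoleFree noEven
  open SectorWheelFree noSector

  private
    V : Set
    V = Fin (n G)

  -- A hole unrolled to a k-periodic sequence, so that its arcs are intervals of ℕ.
  record Ring (k : ℕ) (h : ℕ → V) : Set where
    field
      long      : 5 ≤ k
      odd       : parity k ≡ 1ℙ
      period    : ∀ i → h (i + k) ≡ h i
      distinct  : ∀ {i j} → i < j → j < i + k → h i ≢ h j
      edge      : ∀ i → h i ~ h (suc i)
      chordless : ∀ {i j} → suc i < j → suc j < i + k → ¬ h i ~ h j

    -- The strict bound leaves out at least one vertex of the hole, so no edge closes the arc up.
    arc : ∀ {a m} → suc (a + m) < a + k → Induced m (h ∘ (a +_))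
    arc {a} {m} short = record
      { distinct  = λ {i} {j} i<j j≤m → distinct (+-monoʳ-< a i<j)
          (≤-trans (s≤s (+-monoʳ-≤ a j≤m)) (≤-trans (<⇒≤ short) (+-monoˡ-≤ k (m≤m+n a i))))
      ; edge      = λ {i} _ → subst (λ l → h (a + i) ~ h l) (≡.sym (+-suc a i)) (edge (a + i))
      ; chordless = λ {i} {j} 1+i<j j≤m → chordless (subst (_< a + j) (+-suc a i) (+-monoʳ-< a 1+i<j))
          (≤-trans (s≤s (s≤s (+-monoʳ-≤ a j≤m))) (≤-trans short (+-monoˡ-≤ k (m≤m+n a i)))) }

    hole : ∀ a → Hole k (h ∘ (a +_))
    hole a = record
      { long      = <⇒≤ long
      ; distinct  = λ {i} {j} i<j j<k → distinct (+-monoʳ-< a i<j)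
          (≤-trans (+-monoʳ-< a j<k) (+-monoˡ-≤ k (m≤m+n a i)))
      ; edge      = λ {i} _ → subst (λ l → h (a + i) ~ h l) (≡.sym (+-suc a i)) (edge (a + i))
      ; closing   = λ {l} 1+l≡k → subst (h (a + l) ~_)
          (trans (cong h (trans (≡.sym (+-suc a l)) (cong (a +_) 1+l≡k)))
            (trans (period a) (cong h (≡.sym (+-identityʳ a))))) (edge (a + l))
      ; chordless = chord }
      where
      chord : ∀ {i j} → suc i < j → j < k → h (a + i) ~ h (a + j) → i ≡ 0 × suc j ≡ k
      chord {i} {j} 1+i<j j<k e with suc (a + j) <? (a + i) + k
      ... | yes p = ⊥-elim (chordless (subst (_< a + j) (+-suc a i) (+-monoʳ-< a 1+i<j)) p e)
      ... | no ¬p = i≡0 , ≤-antisym j<k (subst (λ l → l + k ≤ suc j) i≡0 i+k≤1+j)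
        where
        i+k≤1+j : i + k ≤ suc j
        i+k≤1+j = +-cancelˡ-≤ a _ _ (≡.subst₂ _≤_ (+-assoc a i k) (≡.sym (+-suc a j)) (≮⇒≥ ¬p))
        i≡0 : i ≡ 0
        i≡0 = n≤0⇒n≡0 (+-cancelʳ-≤ k i 0 (≤-trans i+k≤1+j j<k))

  Link : (ℕ → V) → ℕ → V → V → Set
  Link h p u w = Σ (ℕ → V) λ g → Induced p g × g 0 ≡ u × g p ≡ w ×
    (∀ {i} → 0 < i → i < p → ∀ j → h j ≢ g i × ¬ h j ~ g i)

  reverse-induced : ∀ {m f} → Induced m f → Induced m (λ i → f (m ∸ i))
  reverse-induced {m} {f} F = record
    { distinct  = λ {i} {j} i<j j≤m e →
        F.distinct (∸-monoʳ-< i<j j≤m) (m∸n≤m m i) (≡.sym e)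
    ; edge      = λ {i} i<m → ~-sym (subst (λ l → f (m ∸ suc i) ~ f l) (≡.sym (suc-∸ i<m))
        (F.edge (subst (_≤ m) (suc-∸ i<m) (m∸n≤m m i))))
    ; chordless = λ {i} {j} 1+i<j j≤m e →
        F.chordless (subst (suc (m ∸ j) <_) (≡.sym (suc-∸ (≤-trans (<⇒≤ 1+i<j) j≤m))) (s≤s (∸-monoʳ-< 1+i<j j≤m)))
          (m∸n≤m m i) (~-sym e) }
    where
    module F = Induced F
    suc-∸ : ∀ {i} → i < m → m ∸ i ≡ suc (m ∸ suc i)
    suc-∸ i<m = +-∸-assoc 1 i<m

  link-sym : ∀ {h p u w} → Link h p u w → Link h p w u
  link-sym {p = p} (g , Q , refl , refl , away) =
    (λ i → g (p ∸ i)) , reverse-induced Q , refl , cong g (n∸n≡0 p) ,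
    λ {i} 0<i i<p → away (m<n⇒0<n∸m i<p) (∸-monoʳ-< 0<i (<⇒≤ i<p))

  link-adjacent : ∀ {h p u w} → Link h p u w → u ~ w → p ≡ 1
  link-adjacent {p = zero}          (g , Q , refl , refl , _) u~w = ⊥-elim (~⇒≢ u~w refl)
  link-adjacent {p = suc zero}      _                         _   = refl
  link-adjacent {p = suc (suc p)}   (g , Q , refl , refl , _) u~w =
    ⊥-elim (Induced.chordless Q (s≤s (s≤s z≤n)) ≤-refl u~w)

  -- All that the argument retains of breadth-first search: `W` stands for the level just before
  -- that of the hole, within the same component.
  record Attachment (k : ℕ) (h : ℕ → V) (W : V → Set) : Set where
    field
      ring    : Ring k h
      outside : ∀ {w} → W w → ∀ i → h i ≢ w
      cover   : ∀ i → ∃ λ w → W w × w ~ h i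
      link    : ∀ {u w} → W u → W w → u ≢ w → ∃ λ p → Link h p u w

  module Attached {k h W} (A : Attachment k h W) where
    open Attachment A
    open Ring ring

    shift-mark : ∀ {w i} → w ~ h i → w ~ h (i + k)
    shift-mark {w} {i} = subst (w ~_) (≡.sym (period i))

    unshift-mark : ∀ {w i} → w ~ h (i + k) → w ~ h i
    unshift-mark {w} {i} = subst (w ~_) (period i)

    -- `wide` and `narrow` say that the ends are nonadjacent on either side, so the arc is an
    -- induced path and closes with `u` to a hole of `y - x + 2` vertices.
    record Gap (u : V) (x y : ℕ) : Set where
      constructor gap
      field
        wide   : 2 + x ≤ y
        narrow : suc y < x + k
        start  : u ~ h x
        end    : u ~ h y
        free   : None (λ i → u ~ h i) (suc x) y

    gapHole : ∀ {u x m} → W u → Gap u x (x + m) → Hole (suc m + 1) (join m (h ∘ (x +_)) (λ _ → u))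
    gapHole {u} {x} {m} wu (gap wide narrow start end free) =
      joinHole (arc narrow) induced-point (≤-trans 2≤m (m≤m+n m 0))
        (~-sym end) (subst (λ i → u ~ h i) (≡.sym (+-identityʳ x)) start)
        (λ {i} _ _ → outside wu (x + i)) cross
      where
      2≤m : 2 ≤ m
      2≤m = +-cancelˡ-≤ x 2 m (subst (_≤ x + m) (+-comm 2 x) wide)
      cross : ∀ {i j} → i ≤ m → j ≤ 0 → h (x + i) ~ u → (i ≡ m × j ≡ 0) ⊎ (i ≡ 0 × j ≡ 0)
      cross {zero}  _   z≤n _ = inj₂ (refl , refl)
      cross {suc i} i<m z≤n e with m≤n⇒m<n∨m≡n i<m
      ... | inj₁ 1+i<m = ⊥-elim (free (subst (suc x ≤_) (≡.sym (+-suc x i)) (s≤s (m≤m+n x i)))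
                                      (+-monoʳ-< x 1+i<m) (~-sym e))
      ... | inj₂ refl  = inj₁ (refl , refl)

    gap-odd : ∀ {u x y} → W u → Gap u x y → parity x ⊕ parity y ≡ 1ℙ
    gap-odd {u} {x} {y} wu g with m≤n⇒∃[o]m+o≡n (≤-trans (m≤n+m x 2) (Gap.wide g))
    ... | m , refl = parity-⊕-odd x m (trans (≡.sym (cong parity (+-comm (suc m) 1))) (hole-odd (gapHole wu g)))

    -- Since `u` and `w` see the arc only at its ends, arc and link close to a chordless cycle with
    -- `b - a + p + 2` vertices. The case `a = b` is allowed and covers a common neighbour.
    arc-odd : ∀ {u w p a b} → W u → W w → u ≢ w → Link h p w u →
              a ≤ b → suc b < a + k → u ~ h a → w ~ h b →
              (∀ {i} → a ≤ i → i ≤ b → u ~ h i → i ≡ a) →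
              (∀ {i} → a ≤ i → i ≤ b → w ~ h i → i ≡ b) →
              parity a ⊕ parity b ⊕ parity p ≡ 1ℙ
    arc-odd {p = p} {a} wu ww u≢w (g , Q , refl , refl , away) a≤b short u~a w~b onlyA onlyB
      with m≤n⇒∃[o]m+o≡n a≤b
    ... | m , refl = cancel a (join-odd (arc short) Q 1≤m+p (~-sym w~b)
            (subst (λ i → g p ~ h i) (≡.sym (+-identityʳ a)) u~a) apart cross)
      where
      cancel : ∀ a → parity (m + p) ≡ 1ℙ → parity a ⊕ parity (a + m) ⊕ parity p ≡ 1ℙ
      cancel a e rewrite +-homo-+ m p | +-homo-+ a m with parity a | parity m
      ... | 0ℙ | _  = e
      ... | 1ℙ | 0ℙ = e
      ... | 1ℙ | 1ℙ = e
      0<p : 0 < p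
      0<p = n≢0⇒n>0 λ p≡0 → u≢w (cong g p≡0)
      1≤m+p : 1 ≤ m + p
      1≤m+p = ≤-trans 0<p (m≤n+m p m)
      apart : ∀ {i j} → i ≤ m → j ≤ p → h (a + i) ≢ g j
      apart {i} {zero}  _ _ = outside ww (a + i)
      apart {i} {suc j} _ j<p with m≤n⇒m<n∨m≡n j<p
      ... | inj₁ 1+j<p = proj₁ (away (s≤s z≤n) 1+j<p (a + i))
      ... | inj₂ refl  = outside wu (a + i)
      cross : ∀ {i j} → i ≤ m → j ≤ p → h (a + i) ~ g j → (i ≡ m × j ≡ 0) ⊎ (i ≡ 0 × j ≡ p)
      cross {i} {zero} i≤m _ e =
        inj₁ (+-cancelˡ-≡ a i m (onlyB (m≤m+n a i) (+-monoʳ-≤ a i≤m) (~-sym e)) , refl)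
      cross {i} {suc j} i≤m j<p e with m≤n⇒m<n∨m≡n j<p
      ... | inj₁ 1+j<p = ⊥-elim (proj₂ (away (s≤s z≤n) 1+j<p (a + i)) e)
      ... | inj₂ refl  = inj₂ (+-cancelˡ-≡ a i 0 (trans (onlyA (m≤m+n a i) (+-monoʳ-≤ a i≤m) (~-sym e))
                                  (≡.sym (+-identityʳ a))) , refl)

    -- One full period is covered, so this describes all neighbours on the hole: a single one if
    -- `a′ = a`, an edge if `a′ = suc a`.
    record Marks (w : V) (a a′ : ℕ) : Set where
      field
        start : w ~ h a
        end   : w ~ h a′
        only  : ∀ {j} → a ≤ j → j < a + k → w ~ h j → j ≡ a ⊎ j ≡ a′

    -- The link closes up both with the arc from `a′` to `b` and with the arc from `b′` to `a + k`,
    -- so these arcs have equal parity. Together they have length `k - (a′ - a) - (b′ - b)`, and `k`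
    -- is odd.
    two-arcs : ∀ {u w a a′ b b′} → W u → W w → u ≢ w → Marks u a a′ → Marks w b b′ →
               a ≤ a′ → a′ ≤ b → b ≤ b′ → b′ ≤ a + k → a < b → b < a + k → a′ < b′ → b′ < a′ + k →
               suc b < a′ + k → suc a < b′ → parity a ⊕ parity a′ ≢ parity b ⊕ parity b′
    two-arcs {u} {w} {a} {a′} {b} {b′} wu ww u≢w Mu Mw
             a≤a′ a′≤b b≤b′ b′≤a+k a<b b<a+k a′<b′ b′<a′+k 1+b<a′+k 1+a<b′ e
      with link ww wu (u≢w ∘ ≡.sym)
    ... | p , ℓ = clash (parity a) (parity a′) (parity b) (parity b′) (parity p) e back forth
      where
      module Mu = Marks Mu
      module Mw = Marks Mw
      start-u : ∀ {i} → a′ ≤ i → i ≤ b → u ~ h i → i ≡ a′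
      start-u a′≤i i≤b m with Mu.only (≤-trans a≤a′ a′≤i) (≤-<-trans i≤b b<a+k) m
      ... | inj₁ refl = ≤-antisym a≤a′ a′≤i
      ... | inj₂ i≡a′ = i≡a′
      end-w : ∀ {i} → a′ ≤ i → i ≤ b → w ~ h i → i ≡ b
      end-w a′≤i i≤b m with m≤n⇒m<n∨m≡n i≤b
      ... | inj₂ i≡b = i≡b
      ... | inj₁ i<b with Mw.only (≤-trans (<⇒≤ b<a+k) (+-monoˡ-≤ k (≤-trans a≤a′ a′≤i)))
                                  (+-monoˡ-< k i<b) (shift-mark m)
      ...   | inj₁ refl = ⊥-elim (<⇒≱ b<a+k (+-monoˡ-≤ k (≤-trans a≤a′ a′≤i)))
      ...   | inj₂ refl = ⊥-elim (<⇒≱ b′<a′+k (+-monoˡ-≤ k a′≤i))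
      forth : parity a′ ⊕ parity b ⊕ parity p ≡ 1ℙ
      forth = arc-odd wu ww u≢w ℓ a′≤b 1+b<a′+k Mu.end Mw.start start-u end-w
      start-w : ∀ {i} → b′ ≤ i → i ≤ a + k → w ~ h i → i ≡ b′
      start-w b′≤i i≤a+k m with Mw.only (≤-trans b≤b′ b′≤i) (≤-<-trans i≤a+k (+-monoˡ-< k a<b)) m
      ... | inj₁ refl = ≤-antisym b≤b′ b′≤i
      ... | inj₂ i≡b′ = i≡b′
      end-u : ∀ {i} → b′ ≤ i → i ≤ a + k → u ~ h i → i ≡ a + k
      end-u b′≤i i≤a+k m with m≤n⇒m<n∨m≡n i≤a+k
      ... | inj₂ i≡a+k = i≡a+k
      ... | inj₁ i<a+k with Mu.only (≤-trans (≤-trans a≤a′ (<⇒≤ a′<b′)) b′≤i) i<a+k m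
      ...   | inj₁ refl = ⊥-elim (<⇒≱ a′<b′ (≤-trans b′≤i a≤a′))
      ...   | inj₂ refl = ⊥-elim (<⇒≱ a′<b′ b′≤i)
      back : parity b′ ⊕ (parity a ⊕ 1ℙ) ⊕ parity p ≡ 1ℙ
      back = subst (λ q → parity b′ ⊕ q ⊕ parity p ≡ 1ℙ) (trans (+-homo-+ a k) (cong (parity a ⊕_) odd))
        (arc-odd ww wu (u≢w ∘ ≡.sym) (link-sym ℓ) b′≤a+k (+-monoˡ-< k 1+a<b′)
          Mw.end (shift-mark Mu.start) start-w end-u)
      clash : ∀ q q′ r r′ s → q ⊕ q′ ≡ r ⊕ r′ → r′ ⊕ (q ⊕ 1ℙ) ⊕ s ≡ 1ℙ → ¬ (q′ ⊕ r ⊕ s ≡ 1ℙ)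
      clash = from-yes (∀ℙ? λ q → ∀ℙ? λ q′ → ∀ℙ? λ r → ∀ℙ? λ r′ → ∀ℙ? λ s →
        (q ⊕ q′ ≟ r ⊕ r′) →-dec (r′ ⊕ (q ⊕ 1ℙ) ⊕ s ≟ 1ℙ) →-dec ¬? (q′ ⊕ r ⊕ s ≟ 1ℙ))

    -- Edges that share an end are included: one of the two arcs then has length 0.
    no-two-edges : ∀ {u w a b} → W u → W w → Marks u a (suc a) → Marks w b (suc b) →
                   a < b → b < a + k → ⊥
    no-two-edges {u} {w} {a} {b} wu ww Mu Mw a<b b<a+k =
      two-arcs wu ww u≢w Mu Mw (n≤1+n a) a<b (n≤1+n b) b<a+k a<b b<a+k (s≤s a<b) (s≤s b<a+k)
        (s≤s b<a+k) (s≤s a<b) (trans (parity-⊕-suc a) (≡.sym (parity-⊕-suc b)))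
      where
      u≢w : u ≢ w
      u≢w refl with Marks.only Mu (<⇒≤ a<b) b<a+k (Marks.start Mw)
      ... | inj₁ refl = <-irrefl refl a<b
      ... | inj₂ refl with Marks.only Mu (m≤n+m a 2) 2+a<a+k (Marks.end Mw)
        where
        2+a<a+k : 2 + a < a + k
        2+a<a+k = subst (_< a + k) (+-comm a 2) (+-monoʳ-< a (≤-trans (m≤m+n 3 2) long))
      ...   | inj₁ e = <-irrefl (≡.sym e) (<-trans (n<1+n _) (n<1+n _))
      ...   | inj₂ e = <-irrefl (≡.sym e) (n<1+n _)

    -- Nonadjacency is essential: between adjacent attachments the longer arc misses no vertex of
    -- the hole and is not induced.
    no-two-singles : ∀ {u w a b} → W u → W w → Marks u a a → Marks w b b →
                     2 + a ≤ b → suc b < a + k → ⊥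
    no-two-singles {u} {w} {a} {b} wu ww Mu Mw 2+a≤b 1+b<a+k =
      two-arcs wu ww u≢w Mu Mw ≤-refl (<⇒≤ a<b) ≤-refl (<⇒≤ b<a+k) a<b b<a+k a<b b<a+k
        1+b<a+k 2+a≤b (trans (p+p≡0ℙ (parity a)) (≡.sym (p+p≡0ℙ (parity b))))
      where
      a<b : a < b
      a<b = <-trans (n<1+n a) 2+a≤b
      b<a+k : b < a + k
      b<a+k = <-trans (n<1+n b) 1+b<a+k
      u≢w : u ≢ w
      u≢w refl with Marks.only Mu (<⇒≤ a<b) b<a+k (Marks.start Mw)
      ... | inj₁ refl = <-irrefl refl a<b
      ... | inj₂ refl = <-irrefl refl a<b

    common-mark-odd : ∀ {u w p x} → W u → W w → u ≢ w → Link h p w u →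
                      u ~ h x → w ~ h x → parity p ≡ 1ℙ
    common-mark-odd {p = p} {x} wu ww u≢w ℓ u~x w~x =
      trans (cong (_⊕ parity p) (≡.sym (p+p≡0ℙ (parity x))))
        (arc-odd wu ww u≢w ℓ ≤-refl (m+2≤m+k x) u~x w~x (λ x≤i i≤x _ → ≤-antisym i≤x x≤i)
          (λ x≤i i≤x _ → ≤-antisym i≤x x≤i))
      where
      m+2≤m+k : ∀ m → 2 + m ≤ m + k
      m+2≤m+k m = subst (_≤ m + k) (+-comm m 2) (+-monoʳ-≤ m (≤-trans (m≤m+n 2 3) long))

    -- The link, the common neighbour h x and a shortest path along the rest of the
    -- hole are three internally disjoint paths from u to w, two of them of equal parity.
    no-theta : ∀ {u w x a b} → W u → W w → u ≢ w → ¬ u ~ w → u ~ h x → w ~ h x →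
               2 + x ≤ a → a ≤ b → suc b < x + k → u ~ h a → w ~ h b → ⊥
    no-theta {u} {w} {x} {a} {b} wu ww u≢w u≁w u~x w~x 2+x≤a a≤b 1+b<x+k u~a w~b
      -- Taking the first mark of `w` from `a` on, and then the last mark of `u` up to it, leaves an
      -- arc that both meet only at its ends.
      with link ww wu (u≢w ∘ ≡.sym) | first (λ i → w ~? h i) a≤b w~b
    ... | p , ℓ | b′ , a≤b′ , b′≤b , w~b′ , before with last (λ i → u ~? h i) a≤b′ u~a
    ...   | a′ , a≤a′ , a′≤b′ , u~a′ , after with m≤n⇒∃[o]m+o≡n a′≤b′
    ...     | m , refl = clash (parity a′) (parity m) (parity p)
                (common-mark-odd wu ww u≢w ℓ u~x w~x)
                (subst (λ q → parity a′ ⊕ q ⊕ parity p ≡ 1ℙ) (+-homo-+ a′ m)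
                  (arc-odd wu ww u≢w ℓ a′≤b′ short u~a′ w~b′ onlyA onlyB))
                (subst (_≡ 1ℙ) (+-homo-+ m 2) around)
      where
      2+x≤a′ : 2 + x ≤ a′
      2+x≤a′ = ≤-trans 2+x≤a a≤a′
      inside : suc (a′ + m) < x + k
      inside = ≤-<-trans (s≤s b′≤b) 1+b<x+k
      short : suc (a′ + m) < a′ + k
      short = <-≤-trans inside (+-monoˡ-≤ k (≤-trans (m≤n+m x 2) 2+x≤a′))
      onlyA : ∀ {i} → a′ ≤ i → i ≤ a′ + m → u ~ h i → i ≡ a′
      onlyA a′≤i i≤b′ e with m≤n⇒m<n∨m≡n a′≤i
      ... | inj₁ a′<i = ⊥-elim (after a′<i (s≤s i≤b′) e)
      ... | inj₂ a′≡i = ≡.sym a′≡i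
      onlyB : ∀ {i} → a′ ≤ i → i ≤ a′ + m → w ~ h i → i ≡ a′ + m
      onlyB a′≤i i≤b′ e with m≤n⇒m<n∨m≡n i≤b′
      ... | inj₁ i<b′ = ⊥-elim (before (≤-trans a≤a′ a′≤i) i<b′ e)
      ... | inj₂ i≡b′ = i≡b′
      bridge : Induced 2 (w ◂ h x ◂ λ _ → u)
      bridge = induced-cons
        (induced-cons induced-point (~-sym u~x) (λ _ → outside wu x) (λ 0<i i≤0 → ⊥-elim (<⇒≱ 0<i i≤0)))
        w~x fresh apart
        where
        fresh : ∀ {i} → i ≤ 1 → w ≢ (h x ◂ λ _ → u) i
        fresh {zero}  _ = outside ww x ∘ ≡.sym
        fresh {suc i} _ = u≢w ∘ ≡.sym
        apart : ∀ {i} → 0 < i → i ≤ 1 → ¬ w ~ (h x ◂ λ _ → u) i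
        apart {suc i} _ _ = u≁w ∘ ~-sym
      around : parity (m + 2) ≡ 1ℙ
      around = join-odd (arc short) bridge (≤-trans (s≤s z≤n) (m≤n+m 2 m)) (~-sym w~b′)
        (subst (λ i → u ~ h i) (≡.sym (+-identityʳ a′)) u~a′) apart cross
        where
        apart : ∀ {i j} → i ≤ m → j ≤ 2 → h (a′ + i) ≢ (w ◂ h x ◂ λ _ → u) j
        apart {i} {0} _ _ = outside ww (a′ + i)
        apart {i} {1} i≤m _ e = distinct
          (≤-trans (≤-trans (n≤1+n (suc x)) 2+x≤a′) (m≤m+n a′ i))
          (≤-<-trans (≤-trans (+-monoʳ-≤ a′ i≤m) (n≤1+n _)) inside) (≡.sym e)
        apart {i} {2} _ _ = outside wu (a′ + i)
        apart {i} {suc (suc (suc _))} _ (s≤s (s≤s ()))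
        cross : ∀ {i j} → i ≤ m → j ≤ 2 → h (a′ + i) ~ (w ◂ h x ◂ λ _ → u) j →
                (i ≡ m × j ≡ 0) ⊎ (i ≡ 0 × j ≡ 2)
        cross {i} {0} i≤m _ e =
          inj₁ (+-cancelˡ-≡ a′ i m (onlyB (m≤m+n a′ i) (+-monoʳ-≤ a′ i≤m) (~-sym e)) , refl)
        cross {i} {1} i≤m _ e = ⊥-elim (chordless (≤-trans 2+x≤a′ (m≤m+n a′ i))
          (≤-<-trans (s≤s (+-monoʳ-≤ a′ i≤m)) inside) (~-sym e))
        cross {i} {2} i≤m _ e =
          inj₂ (+-cancelˡ-≡ a′ i 0 (trans (onlyA (m≤m+n a′ i) (+-monoʳ-≤ a′ i≤m) (~-sym e))
                  (≡.sym (+-identityʳ a′))) , refl)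
        cross {i} {suc (suc (suc _))} _ (s≤s (s≤s ()))
      clash : ∀ q r s → s ≡ 1ℙ → q ⊕ (q ⊕ r) ⊕ s ≡ 1ℙ → r ⊕ 0ℙ ≢ 1ℙ
      clash = from-yes (∀ℙ? λ q → ∀ℙ? λ r → ∀ℙ? λ s →
        (s ≟ 1ℙ) →-dec (q ⊕ (q ⊕ r) ⊕ s ≟ 1ℙ) →-dec ¬? (r ⊕ 0ℙ ≟ 1ℙ))

    -- The number of neighbours on the hole modulo 2.

    mark : V → ℕ → Parity
    mark u i = bit (adj G u (h i))

    mark-yes : ∀ {u i} → u ~ h i → mark u i ≡ 1ℙ
    mark-yes = cong bit

    mark-no : ∀ {u i} → ¬ u ~ h i → mark u i ≡ 0ℙ
    mark-no {u} {i} ¬e with adj G u (h i)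
    ... | true  = ⊥-elim (¬e refl)
    ... | false = refl

    mark-~ : ∀ {u i} → mark u i ≡ 1ℙ → u ~ h i
    mark-~ {u} {i} e with adj G u (h i)
    ... | true = refl

    -- A mark `m` not adjacent to the mark `s` breaks up the period from `s` to `s + k`: consecutive
    -- marks cannot straddle it, so every arc between them misses a vertex of the hole.
    consecutive-short : ∀ {s m i j} → 2 + s ≤ m → suc m < s + k →
                        s ≤ i → j ≤ s + k → ¬ (i < m × m < j) → suc j < i + k
    consecutive-short {s} {m} {i} {j} 2+s≤m 1+m<s+k s≤i j≤s+k apart with m ≤? i
    ... | yes m≤i = ≤-trans (s≤s (s≤s j≤s+k)) (+-monoˡ-≤ k (≤-trans 2+s≤m m≤i))
    ... | no m≰i with j ≤? m
    ...   | yes j≤m = ≤-trans (s≤s (s≤s j≤m)) (≤-trans 1+m<s+k (+-monoˡ-≤ k s≤i))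
    ...   | no j≰m  = ⊥-elim (apart (≰⇒> m≰i , ≰⇒> j≰m))

    consecutive-odd : ∀ {u i j} → W u → i < j → suc j < i + k → u ~ h i → u ~ h j →
                      None (λ l → u ~ h l) (suc i) j → parity i ⊕ parity j ≡ 1ℙ
    consecutive-odd {u} {i} wu i<j short u~i u~j none with m≤n⇒m<n∨m≡n i<j
    ... | inj₁ 1+i<j = gap-odd wu (gap 1+i<j short u~i u~j none)
    ... | inj₂ refl  = parity-⊕-suc i

    total-period : ∀ χ s → χ s ≡ 1ℙ → χ (s + k) ≡ 1ℙ → OddGaps χ s (s + k) →
                   total χ s ⊕ total χ (s + k) ≡ 1ℙ
    total-period χ s e e′ gaps =
      trans (total-odd-gaps χ (m≤m+n s k) e e′ gaps) (parity-⊕-odd s k odd)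

    -- The distances between consecutive neighbours are odd and add up to the odd `k`, so the
    -- neighbours are odd in number; the nonadjacent neighbour `h m` keeps each arc between them
    -- induced.
    marks-total : ∀ {u s m} → W u → 2 + s ≤ m → suc m < s + k → u ~ h s → u ~ h m →
                  total (mark u) s ⊕ total (mark u) (s + k) ≡ 1ℙ
    marks-total {u} {s} wu 2+s≤m 1+m<s+k u~s u~m =
      total-period (mark u) s (mark-yes u~s) (mark-yes (shift-mark u~s)) λ s≤i i<j j≤s+k ui uj none →
        consecutive-odd wu i<j
          (consecutive-short 2+s≤m 1+m<s+k s≤i j≤s+k λ (i<m , m<j) → none i<m m<j (mark-yes u~m))
          (mark-~ ui) (mark-~ uj) (λ i<l l<j e → none i<l l<j (mark-yes e))

    -- Consecutive marks of u, of w and of both together are at odd distance, so each of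
    -- the three sets has the parity of the hole, yet the third is the disjoint union of
    -- the first two.
    no-disjoint-wheels : ∀ {u w p x y c} → W u → W w → u ≢ w → Link h p w u → parity p ≡ 0ℙ →
      u ~ h x → 2 + x ≤ y → suc y < x + k → u ~ h y →
      w ~ h (suc x) → y < c → c < x + k → w ~ h c → ⊥
    no-disjoint-wheels {u} {w} {p} {x} {y} {c} wu ww u≢w ℓ even u~x 2+x≤y 1+y<x+k u~y w~1+x y<c c<x+k w~c =
      -- The count for `w` runs over the period starting at `suc x`, that for `u` over the one
      -- starting at `x`. As `w` does not see `h x`, both can be compared over the latter.
      clash (total (mark u) x) (total (mark u) (x + k)) (total (mark w) x) (total (mark w) (x + k))
        (mark w x) (mark w (x + k)) (mark-no (disjoint u~x)) (mark-no (disjoint (shift-mark u~x)))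
        (marks-total wu 2+x≤y 1+y<x+k u~x u~y)
        (marks-total ww (≤-trans (s≤s 2+x≤y) y<c) (s≤s c<x+k) w~1+x w~c)
        (≡.subst₂ (λ q r → q ⊕ r ≡ 1ℙ) (total-⊕ (mark u) (mark w) x) (total-⊕ (mark u) (mark w) (x + k)) both)
      where
      disjoint : ∀ {i} → u ~ h i → ¬ w ~ h i
      disjoint u~i w~i = case trans (≡.sym even) (common-mark-odd wu ww u≢w ℓ u~i w~i) of λ ()
      χ : ℕ → Parity
      χ i = mark u i ⊕ mark w i
      χ-u : ∀ {i} → u ~ h i → χ i ≡ 1ℙ
      χ-u e = ≡.cong₂ _⊕_ (mark-yes e) (mark-no (disjoint e))
      χ-w : ∀ {i} → w ~ h i → χ i ≡ 1ℙ
      χ-w e = ≡.cong₂ _⊕_ (mark-no (λ e′ → disjoint e′ e)) (mark-yes e)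
      χ-~ : ∀ {i} → χ i ≡ 1ℙ → u ~ h i ⊎ w ~ h i
      χ-~ {i} e with mark u i in eq
      ... | 1ℙ = inj₁ (mark-~ eq)
      ... | 0ℙ = inj₂ (mark-~ e)
      drop-p : ∀ q r → q ⊕ r ⊕ parity p ≡ 1ℙ → q ⊕ r ≡ 1ℙ
      drop-p q r e = trans (≡.sym (⊕-identityʳ (q ⊕ r))) (trans (cong (q ⊕ r ⊕_) (≡.sym even)) e)
      both : total χ x ⊕ total χ (x + k) ≡ 1ℙ
      both = total-period χ x (χ-u u~x) (χ-u (shift-mark u~x)) gaps
        where
        gaps : OddGaps χ x (x + k)
        gaps {i} {j} x≤i i<j j≤x+k ci cj none = by (χ-~ ci) (χ-~ cj)
          where
          short : suc j < i + k
          short = consecutive-short 2+x≤y 1+y<x+k x≤i j≤x+k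
            λ (i<y , y<j) → none i<y y<j (χ-u u~y)
          only-start : ∀ {v} → (∀ {l} → v ~ h l → χ l ≡ 1ℙ) → ¬ v ~ h j →
                       ∀ {l} → i ≤ l → l ≤ j → v ~ h l → l ≡ i
          only-start χ-v v≁j i≤l l≤j e with m≤n⇒m<n∨m≡n i≤l | m≤n⇒m<n∨m≡n l≤j
          ... | inj₂ i≡l | _         = ≡.sym i≡l
          ... | _        | inj₂ refl = ⊥-elim (v≁j e)
          ... | inj₁ i<l | inj₁ l<j  = ⊥-elim (none i<l l<j (χ-v e))
          only-end : ∀ {v} → (∀ {l} → v ~ h l → χ l ≡ 1ℙ) → ¬ v ~ h i →
                     ∀ {l} → i ≤ l → l ≤ j → v ~ h l → l ≡ j
          only-end χ-v v≁i i≤l l≤j e with m≤n⇒m<n∨m≡n i≤l | m≤n⇒m<n∨m≡n l≤j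
          ... | _         | inj₂ l≡j = l≡j
          ... | inj₂ refl | _        = ⊥-elim (v≁i e)
          ... | inj₁ i<l  | inj₁ l<j = ⊥-elim (none i<l l<j (χ-v e))
          by : u ~ h i ⊎ w ~ h i → u ~ h j ⊎ w ~ h j → parity i ⊕ parity j ≡ 1ℙ
          by (inj₁ a) (inj₁ b) = consecutive-odd wu i<j short a b λ i<l l<j → none i<l l<j ∘ χ-u
          by (inj₂ a) (inj₂ b) = consecutive-odd ww i<j short a b λ i<l l<j → none i<l l<j ∘ χ-w
          by (inj₁ a) (inj₂ b) = drop-p (parity i) (parity j) (arc-odd wu ww u≢w ℓ (<⇒≤ i<j) short a b
            (only-start χ-u λ e → disjoint e b) (only-end χ-w (disjoint a)))
          by (inj₂ a) (inj₁ b) = drop-p (parity i) (parity j)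
            (arc-odd ww wu (u≢w ∘ ≡.sym) (link-sym ℓ) (<⇒≤ i<j) short a b
            (only-start χ-w (disjoint b)) (only-end χ-u λ e → disjoint e a))
      clash : ∀ q q′ r r′ s s′ → s ≡ 0ℙ → s′ ≡ 0ℙ → q ⊕ q′ ≡ 1ℙ → r ⊕ s ⊕ (r′ ⊕ s′) ≡ 1ℙ →
              q ⊕ r ⊕ (q′ ⊕ r′) ≢ 1ℙ
      clash = from-yes (∀ℙ? λ q → ∀ℙ? λ q′ → ∀ℙ? λ r → ∀ℙ? λ r′ → ∀ℙ? λ s → ∀ℙ? λ s′ →
        (s ≟ 0ℙ) →-dec (s′ ≟ 0ℙ) →-dec (q ⊕ q′ ≟ 1ℙ) →-dec (r ⊕ s ⊕ (r′ ⊕ s′) ≟ 1ℙ) →-dec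
        ¬? (q ⊕ r ⊕ (q′ ⊕ r′) ≟ 1ℙ))

    -- Sector wheels around the hole closed by a gap.

    on-gapHole : ∀ {u x m} → (wu : W u) → (g : Gap u x (x + m)) → (P : V → Set) →
                 P u → (∀ {i} → x ≤ i → i ≤ x + m → P (h i)) →
                 ∀ {l} → l < suc m + 1 → P (join m (h ∘ (x +_)) (λ _ → u) l)
    on-gapHole {u} {x} {m} wu g P pu ph {l} l<k with side m 0 l<k
    ... | left l≤m    = subst P (≡.sym (join-left l≤m)) (ph (m≤m+n x l) (+-monoʳ-≤ x l≤m))
    ... | right zero _ = subst P (≡.sym (join-right m zero)) pu

    gapHole-no-universal : ∀ {u w x y} → W u → Gap u x y → w ~ u →
                           (∀ {i} → x ≤ i → i ≤ y → w ~ h i) → ⊥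
    gapHole-no-universal {w = w} {x} wu g w~u all with m≤n⇒∃[o]m+o≡n (≤-trans (m≤n+m x 2) (Gap.wide g))
    ... | m , refl = no-universal (gapHole wu g) (on-gapHole wu g (w ~_) w~u all)

    -- The neighbours of w on the hole are u followed by an initial segment of the arc.
    gapHole-no-prefix : ∀ {u w x y z} → W u → W w → u ≢ w → Gap u x y → w ~ u → x < z → z < y →
                        (∀ {i} → x ≤ i → i ≤ z → w ~ h i) → None (λ i → w ~ h i) (suc z) (suc y) → ⊥
    gapHole-no-prefix {u} {w} {x} {z = z} wu ww u≢w g w~u x<z z<y all none
      with m≤n⇒∃[o]m+o≡n (≤-trans (m≤n+m x 2) (Gap.wide g)) | m≤n⇒∃[o]m+o≡n (<⇒≤ x<z)
    ... | m , refl | d , refl = no-path-sector (gapHole wu g)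
            (on-gapHole wu g (_≢ w) u≢w λ {i} _ _ → outside ww i)
            fan (s≤s 1≤d) onHole nbr
            (on-gapHole wu g (λ v → w ~ v → ∃ λ i → i ≤ suc d × fanSeq i ≡ v) (λ _ → 0 , z≤n , refl) hit)
      where
      1≤d : 1 ≤ d
      1≤d = +-cancelˡ-≤ x 1 d (subst (_≤ x + d) (+-comm 1 x) x<z)
      d<m : d < m
      d<m = +-cancelˡ-< x d m z<y
      fanSeq : ℕ → V
      fanSeq = u ◂ h ∘ (x +_)
      blades : Induced d (h ∘ (x +_))
      blades = arc (<-trans (s≤s z<y) (Gap.narrow g))
      fan : Induced (suc d) fanSeq
      fan = induced-cons blades (subst (λ l → u ~ h l) (≡.sym (+-identityʳ x)) (Gap.start g))
        (λ {i} _ e → outside wu (x + i) (≡.sym e))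
        (λ 0<i i≤d → Gap.free g (m<m+n x 0<i) (≤-<-trans (+-monoʳ-≤ x i≤d) z<y))
      onHole : ∀ {i} → i ≤ suc d → ∃ λ l → l < suc m + 1 × join m (h ∘ (x +_)) (λ _ → u) l ≡ fanSeq i
      onHole {zero}  _         = suc m + 0 , +-monoʳ-< (suc m) (s≤s z≤n) , join-right m 0
      onHole {suc i} (s≤s i≤d) = i , m≤n⇒m≤n+o 1 (s≤s i≤m) , join-left i≤m
        where
        i≤m : i ≤ m
        i≤m = ≤-trans i≤d (<⇒≤ d<m)
      nbr : ∀ {i} → i ≤ suc d → w ~ fanSeq i
      nbr {zero}  _         = w~u
      nbr {suc i} (s≤s i≤d) = all (m≤m+n x i) (+-monoʳ-≤ x i≤d)
      hit : ∀ {i} → x ≤ i → i ≤ x + m → w ~ h i → ∃ λ j → j ≤ suc d × fanSeq j ≡ h i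
      hit {i} x≤i i≤y e with m≤n⇒∃[o]m+o≡n x≤i | i ≤? x + d
      ... | j , refl | yes i≤z = suc j , s≤s (+-cancelˡ-≤ x j d i≤z) , refl
      ... | _        | no i≰z  = ⊥-elim (none (≰⇒> i≰z) (s≤s i≤y) e)

    gapHole-no-segment : ∀ {u w x y a z} → W u → W w → u ≢ w → Gap u x y → ¬ w ~ u → x ≤ a →
                         2 + a ≤ z → z < y → (∀ {i} → a ≤ i → i ≤ z → w ~ h i) →
                         (∀ {i} → x ≤ i → i ≤ y → w ~ h i → a ≤ i × i ≤ z) → ⊥
    gapHole-no-segment {u} {w} {x} {y} {a} {z} wu ww u≢w g w≁u x≤a 2+a≤z z<y all within
      with m≤n⇒∃[o]m+o≡n (≤-trans (m≤n+m x 2) (Gap.wide g)) | m≤n⇒∃[o]m+o≡n (≤-trans (m≤n+m a 2) 2+a≤z)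
         | m≤n⇒∃[o]m+o≡n x≤a
    ... | m , refl | d , refl | b , refl = no-path-sector (gapHole wu g)
            (on-gapHole wu g (_≢ w) u≢w λ {i} _ _ → outside ww i)
            (arc (≤-<-trans (s≤s (<⇒≤ z<y)) (<-≤-trans (Gap.narrow g) (+-monoˡ-≤ k x≤a))))
            (+-cancelˡ-≤ a 2 d (subst (_≤ a + d) (+-comm 2 a) 2+a≤z)) onHole
            (λ {i} i≤d → all (m≤m+n a i) (+-monoʳ-≤ a i≤d))
            (on-gapHole wu g (λ v → w ~ v → ∃ λ i → i ≤ d × h (a + i) ≡ v) (⊥-elim ∘ w≁u) hit)
      where
      onHole : ∀ {i} → i ≤ d → ∃ λ l → l < suc m + 1 × join m (h ∘ (x +_)) (λ _ → u) l ≡ h (a + i)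
      onHole {i} i≤d = b + i , m≤n⇒m≤n+o 1 (s≤s b+i≤m) ,
        trans (join-left b+i≤m) (cong h (≡.sym (+-assoc x b i)))
        where
        b+i≤m : b + i ≤ m
        b+i≤m = +-cancelˡ-≤ x _ _ (subst (_≤ x + m) (+-assoc x b i)
          (≤-trans (+-monoʳ-≤ a i≤d) (<⇒≤ z<y)))
      hit : ∀ {i} → x ≤ i → i ≤ x + m → w ~ h i → ∃ λ j → j ≤ d × h (a + j) ≡ h i
      hit x≤i i≤y e with within x≤i i≤y e
      ... | a≤i , i≤z with m≤n⇒∃[o]m+o≡n a≤i
      ...   | j , refl = j , +-cancelˡ-≤ a j d i≤z , refl

    ring-no-segment : ∀ {w a z} → W w → 2 + a ≤ z → suc z < a + k →
                      (∀ {i} → a ≤ i → i ≤ z → w ~ h i) →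
                      None (λ i → w ~ h i) (suc z) (a + k) → ⊥
    ring-no-segment {w} {a} ww 2+a≤z short all none with m≤n⇒∃[o]m+o≡n (≤-trans (m≤n+m a 2) 2+a≤z)
    ... | d , refl = no-path-sector (hole a) (λ {l} _ → outside ww (a + l)) (arc short)
            (+-cancelˡ-≤ a 2 d (subst (_≤ a + d) (+-comm 2 a) 2+a≤z))
            (λ {i} i≤d → i , ≤-<-trans i≤d d<k , refl)
            (λ {i} i≤d → all (m≤m+n a i) (+-monoʳ-≤ a i≤d)) hit
      where
      d<k : d < k
      d<k = +-cancelˡ-< a d k (<-trans (n<1+n _) short)
      hit : ∀ {l} → l < k → w ~ h (a + l) → ∃ λ i → i ≤ d × h (a + i) ≡ h (a + l)
      hit {l} l<k e with l ≤? d
      ... | yes l≤d = l , l≤d , refl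
      ... | no l≰d  = ⊥-elim (none (+-monoʳ-< a (≰⇒> l≰d)) (+-monoʳ-< a l<k) e)

    -- An exact edge inside every gap.

    initial-segment : ∀ {w a b} → w ~ h a → a ≤ b → suc b < a + k →
      (∃ λ c → ∃ λ d → a ≤ c × d ≤ b × Gap w c d) ⊎
      (∃ λ z → a ≤ z × z ≤ b × (∀ {i} → a ≤ i → i ≤ z → w ~ h i) × None (λ i → w ~ h i) (suc z) (suc b))
    initial-segment {w} {a} {b} w~a a≤b short with search (λ i → ¬? (w ~? h i)) a (suc b)
    ... | inj₂ none = inj₂ (b , a≤b , ≤-refl , (λ a≤i i≤b → decidable-stable (w ~? h _) (none a≤i (s≤s i≤b))) ,
            λ b<i i<1+b → ⊥-elim (<⇒≱ b<i (≤-pred i<1+b)))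
    ... | inj₁ (zero , z≤n , _ , w≁0 , _) = ⊥-elim (w≁0 w~a)
    ... | inj₁ (suc z , a≤1+z , z<b , w≁1+z , none) with m≤n⇒m<n∨m≡n a≤1+z
    ...   | inj₂ refl = ⊥-elim (w≁1+z w~a)
    ...   | inj₁ a<1+z with search (λ i → w ~? h i) (suc z) (suc b)
    ...     | inj₂ none′ = inj₂ (z , ≤-pred a<1+z , ≤-trans (n≤1+n z) (≤-pred z<b) ,
                (λ a≤i i≤z → decidable-stable (w ~? h _) (none a≤i (s≤s i≤z))) , none′)
    ...     | inj₁ (d , z<d , d<1+b , w~d , before) = inj₁ (z , d , ≤-pred a<1+z , ≤-pred d<1+b ,
                gap (≤∧≢⇒< z<d λ where refl → w≁1+z w~d)
                    (≤-<-trans d<1+b (<-≤-trans short (+-monoˡ-≤ k (≤-pred a<1+z))))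
                    (decidable-stable (w ~? h _) (none (≤-pred a<1+z) ≤-refl)) w~d before)

    -- The edge from `h x` to `h (suc x)` is itself an arc: `u` sees only its first end and `w` only
    -- its second, so it closes with the link to a cycle of `p + 3` vertices.
    link-even : ∀ {u w p x y} → W u → W w → u ≢ w → Link h p w u → Gap u x y →
                w ~ h (suc x) → ¬ w ~ h x → parity p ≡ 0ℙ
    link-even {u} {w} {p} {x} wu ww u≢w ℓ g w~1+x w≁x =
      clash (parity x) (parity (suc x)) (parity p) (parity-⊕-suc x)
        (arc-odd wu ww u≢w ℓ (n≤1+n x) (subst (_< x + k) (+-comm x 2) (+-monoʳ-< x (≤-trans (m≤m+n 3 2) long)))
          (Gap.start g) w~1+x start end)
      where
      start : ∀ {i} → x ≤ i → i ≤ suc x → u ~ h i → i ≡ x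
      start x≤i i≤1+x e with m≤n⇒m<n∨m≡n x≤i
      ... | inj₂ x≡i = ≡.sym x≡i
      ... | inj₁ x<i = ⊥-elim (Gap.free g x<i (<-≤-trans (s≤s i≤1+x) (Gap.wide g)) e)
      end : ∀ {i} → x ≤ i → i ≤ suc x → w ~ h i → i ≡ suc x
      end x≤i i≤1+x e with m≤n⇒m<n∨m≡n x≤i
      ... | inj₂ refl = ⊥-elim (w≁x e)
      ... | inj₁ x<i  = ≤-antisym i≤1+x x<i
      clash : ∀ q r s → q ⊕ r ≡ 1ℙ → q ⊕ r ⊕ s ≡ 1ℙ → s ≡ 0ℙ
      clash = from-yes (∀ℙ? λ q → ∀ℙ? λ r → ∀ℙ? λ s →
        (q ⊕ r ≟ 1ℙ) →-dec (q ⊕ r ⊕ s ≟ 1ℙ) →-dec (s ≟ 0ℙ))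

    -- Since `u` also sees `h y`, any neighbour of `w` on the hole at distance at least two from the
    -- common neighbour `h x` yields a theta. The only other candidate, the predecessor of `h x`,
    -- would leave `w` with exactly three consecutive neighbours, a sector wheel.
    shared-start : ∀ {u w x y} → W u → W w → u ≢ w → ¬ u ~ w → Gap u x y →
                   w ~ h x → w ~ h (suc x) → Marks w x (suc x)
    shared-start {u} {w} {x} {y} wu ww u≢w u≁w g w~x w~1+x = record
      { start = w~x ; end = w~1+x ; only = only }
      where
      far : ∀ {i} → 2 + x ≤ i → suc i < x + k → ¬ w ~ h i
      far {i} 2+x≤i 1+i<x+k e with y ≤? i
      ... | yes y≤i = no-theta wu ww u≢w u≁w (Gap.start g) w~x (Gap.wide g) y≤i 1+i<x+k (Gap.end g) e
      ... | no y≰i  = no-theta ww wu (u≢w ∘ ≡.sym) (u≁w ∘ ~-sym) w~x (Gap.start g) 2+x≤i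
                        (<⇒≤ (≰⇒> y≰i)) (Gap.narrow g) e (Gap.end g)
      before : ∀ {l} → suc l ≡ x + k → ¬ w ~ h l
      before {l} e w~l = ring-no-segment ww ≤-refl
        (subst (_< l + k) (+-comm l 3) (+-monoʳ-< l (≤-trans (m≤m+n 4 1) long))) all none
        where
        all : ∀ {i} → l ≤ i → i ≤ 2 + l → w ~ h i
        all l≤i i≤2+l with m≤n⇒m<n∨m≡n l≤i
        ... | inj₂ refl = w~l
        ... | inj₁ l<i with m≤n⇒m<n∨m≡n l<i
        ...   | inj₂ refl  = subst (λ j → w ~ h j) (≡.sym e) (shift-mark w~x)
        ...   | inj₁ 1+l<i = subst (λ j → w ~ h j) (trans (cong suc (≡.sym e)) (≤-antisym 1+l<i i≤2+l))
                               (shift-mark w~1+x)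
        none : None (λ i → w ~ h i) (3 + l) (l + k)
        none {i} 3+l≤i i<l+k m with m≤n⇒∃[o]m+o≡n (≤-trans (m≤n+m (suc l) 2) 3+l≤i)
        ... | o , refl = far 2+x≤x+o 1+x+o<x+k (unshift-mark (subst (λ j → w ~ h j) eq m))
          where
          eq : suc l + o ≡ x + o + k
          eq = trans (cong (_+ o) e)
            (trans (+-assoc x k o) (trans (cong (x +_) (+-comm k o)) (≡.sym (+-assoc x o k))))
          2+x≤x+o : 2 + x ≤ x + o
          2+x≤x+o = +-cancelʳ-≤ k (2 + x) (x + o) (≡.subst₂ _≤_ (cong (2 +_) e) eq 3+l≤i)
          1+x+o<x+k : suc (x + o) < x + k
          1+x+o<x+k = subst (suc (x + o) <_) e (s≤s (+-cancelʳ-< k (x + o) l (subst (_< l + k) eq i<l+k)))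
      only : ∀ {j} → x ≤ j → j < x + k → w ~ h j → j ≡ x ⊎ j ≡ suc x
      only x≤j j<x+k m with m≤n⇒m<n∨m≡n x≤j
      ... | inj₂ x≡j = inj₁ (≡.sym x≡j)
      ... | inj₁ x<j with m≤n⇒m<n∨m≡n x<j
      ...   | inj₂ 1+x≡j = inj₂ (≡.sym 1+x≡j)
      ...   | inj₁ 1+x<j with m≤n⇒m<n∨m≡n j<x+k
      ...     | inj₁ 1+j<x+k = ⊥-elim (far 1+x<j 1+j<x+k m)
      ...     | inj₂ 1+j≡x+k = ⊥-elim (before 1+j≡x+k m)

    -- Cases on the interval from `suc x` to `z`. If it reaches `y`, the common neighbour forces `p`
    -- to be odd; a single vertex contradicts `gap-odd` for `u`; three or more give a sector wheel
    -- on the hole closed by the gap. Two remain, and a further neighbour beyond `y` is excluded by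
    -- `no-disjoint-wheels`.
    inner-edge : ∀ {u w p x y z} → W u → W w → u ≢ w → ¬ w ~ u → Link h p w u → parity p ≡ 0ℙ →
                 Gap u x y → ¬ w ~ h x → x < z → z ≤ y →
                 (∀ {i} → x < i → i ≤ z → w ~ h i) → None (λ i → w ~ h i) (suc z) (suc y) →
                 Marks w (suc x) (2 + x) × 2 + x < y
    inner-edge {u} {w} {p} {x} {y} {z} wu ww u≢w w≁u ℓ even g w≁x x<z z≤y all none
      with m≤n⇒m<n∨m≡n z≤y
    ... | inj₂ refl = case trans (≡.sym even) (common-mark-odd wu ww u≢w ℓ (Gap.end g) (all x<z ≤-refl)) of λ ()
    ... | inj₁ z<y with m≤n⇒m<n∨m≡n x<z
    ...   | inj₂ refl = ⊥-elim (clash (parity x) (parity (suc x)) (parity y) (parity p) even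
              (parity-⊕-suc x) (gap-odd wu g)
              (arc-odd ww wu (u≢w ∘ ≡.sym) (link-sym ℓ) z≤y (<-trans (Gap.narrow g) (n<1+n _))
                (all x<z ≤-refl) (Gap.end g) start end))
      where
      start : ∀ {i} → suc x ≤ i → i ≤ y → w ~ h i → i ≡ suc x
      start x<i i≤y e with m≤n⇒m<n∨m≡n x<i
      ... | inj₂ 1+x≡i = ≡.sym 1+x≡i
      ... | inj₁ 1+x<i = ⊥-elim (none 1+x<i (s≤s i≤y) e)
      end : ∀ {i} → suc x ≤ i → i ≤ y → u ~ h i → i ≡ y
      end x<i i≤y e with m≤n⇒m<n∨m≡n i≤y
      ... | inj₂ i≡y = i≡y
      ... | inj₁ i<y = ⊥-elim (Gap.free g x<i i<y e)
      clash : ∀ q q′ r s → s ≡ 0ℙ → q ⊕ q′ ≡ 1ℙ → q ⊕ r ≡ 1ℙ → q′ ⊕ r ⊕ s ≢ 1ℙ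
      clash = from-yes (∀ℙ? λ q → ∀ℙ? λ q′ → ∀ℙ? λ r → ∀ℙ? λ s →
        (s ≟ 0ℙ) →-dec (q ⊕ q′ ≟ 1ℙ) →-dec (q ⊕ r ≟ 1ℙ) →-dec ¬? (q′ ⊕ r ⊕ s ≟ 1ℙ))
    ...   | inj₁ 1+x<z with m≤n⇒m<n∨m≡n 1+x<z
    ...     | inj₁ 2+x<z = ⊥-elim (gapHole-no-segment wu ww u≢w g w≁u (n≤1+n x) 2+x<z z<y all λ x≤i i≤y e →
                (≤∧≢⇒< x≤i λ where refl → w≁x e) , ≮⇒≥ λ z<i → none z<i (s≤s i≤y) e)
    ...     | inj₂ refl with search (λ i → w ~? h i) (suc y) (x + k)
    ...       | inj₁ (c , y<c , c<x+k , w~c , _) = ⊥-elim (no-disjoint-wheels wu ww u≢w ℓ even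
                  (Gap.start g) (Gap.wide g) (Gap.narrow g) (Gap.end g) (all ≤-refl x<z) y<c c<x+k w~c)
    ...       | inj₂ none′ = record { start = all ≤-refl x<z ; end = all x<z ≤-refl ; only = only } , z<y
      where
      only : ∀ {j} → suc x ≤ j → j < suc x + k → w ~ h j → j ≡ suc x ⊎ j ≡ 2 + x
      only {j} x<j j<1+x+k e with m≤n⇒m<n∨m≡n x<j
      ... | inj₂ 1+x≡j = inj₁ (≡.sym 1+x≡j)
      ... | inj₁ 1+x<j with m≤n⇒m<n∨m≡n 1+x<j
      ...   | inj₂ 2+x≡j = inj₂ (≡.sym 2+x≡j)
      ...   | inj₁ 2+x<j with j ≤? y
      ...     | yes j≤y = ⊥-elim (none 2+x<j (s≤s j≤y) e)
      ...     | no j≰y with m<1+n⇒m<n∨m≡n j<1+x+k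
      ...       | inj₁ j<x+k = ⊥-elim (none′ (≰⇒> j≰y) j<x+k e)
      ...       | inj₂ refl  = ⊥-elim (w≁x (unshift-mark e))

    -- Induction on a bound `N` for the length of the gap. A vertex `w` covering `h (suc x)` may
    -- have a gap inside this one, shorter because it starts after `x`; otherwise its neighbours
    -- there form an interval. If `w` sees `u`, then seeing `h x` gives a sector wheel, and not
    -- seeing it gives a link of length 1 that should be even. If `w` does not see `u`, then
    -- `shared-start` or `inner-edge` applies.
    gap-edge : ∀ N {u x y} → W u → Gap u x y → y < x + N →
               ∃ λ w → ∃ λ e → W w × Marks w e (suc e) × x ≤ e × suc e < y
    gap-edge zero {x = x} wu g y<x+0 =
      ⊥-elim (<⇒≱ (subst (_ <_) (+-identityʳ x) y<x+0) (≤-trans (m≤n+m x 2) (Gap.wide g)))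
    gap-edge (suc N) {u} {x} {y} wu g y<x+1+N with cover (suc x)
    ... | w , ww , w~1+x with initial-segment w~1+x x<y (<-trans (Gap.narrow g) (n<1+n _))
      where
      x<y : x < y
      x<y = ≤-trans (n≤1+n (suc x)) (Gap.wide g)
    ...   | inj₁ (c , d , x<c , d≤y , g′) =
              let (v , e , wv , M , c≤e , e<d) = gap-edge N ww g′ d<c+N
              in v , e , wv , M , ≤-trans (<⇒≤ x<c) c≤e , <-≤-trans e<d d≤y
      where
      d<c+N : d < c + N
      d<c+N = ≤-trans (≤-<-trans d≤y (subst (y <_) (+-suc x N) y<x+1+N)) (+-monoˡ-≤ N x<c)
    ...   | inj₂ (z , x<z , z≤y , all , none) = run (w ~? u) (w ~? h x)
      where
      u≢w : u ≢ w
      u≢w refl = Gap.free g ≤-refl (Gap.wide g) w~1+x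
      all′ : w ~ h x → ∀ {i} → x ≤ i → i ≤ z → w ~ h i
      all′ w~x x≤i i≤z with m≤n⇒m<n∨m≡n x≤i
      ... | inj₁ x<i  = all x<i i≤z
      ... | inj₂ refl = w~x
      run : Dec (w ~ u) → Dec (w ~ h x) →
            ∃ λ w → ∃ λ e → W w × Marks w e (suc e) × x ≤ e × suc e < y
      run (yes w~u) (yes w~x) with m≤n⇒m<n∨m≡n z≤y
      ... | inj₁ z<y  = ⊥-elim (gapHole-no-prefix wu ww u≢w g w~u x<z z<y (all′ w~x) none)
      ... | inj₂ refl = ⊥-elim (gapHole-no-universal wu g w~u (all′ w~x))
      run (yes w~u) (no w≁x) with link ww wu (u≢w ∘ ≡.sym)
      ... | p , ℓ = case trans (≡.sym (cong parity (link-adjacent ℓ w~u)))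
                           (link-even wu ww u≢w ℓ g w~1+x w≁x) of λ ()
      run (no w≁u) (yes w~x) =
        w , x , ww , shared-start wu ww u≢w (w≁u ∘ ~-sym) g w~x w~1+x , ≤-refl , Gap.wide g
      run (no w≁u) (no w≁x) with link ww wu (u≢w ∘ ≡.sym)
      ... | p , ℓ with inner-edge wu ww u≢w w≁u ℓ (link-even wu ww u≢w ℓ g w~1+x w≁x) g w≁x x<z z≤y all none
      ...   | M , 2+x<y = w , suc x , ww , M , n≤1+n x , 2+x<y

    -- The shift by `k` gives the predecessor of `h i` a position even for `i = 0`; the edge may
    -- begin at `i + k` or one before.
    Single Edge : ℕ → Set
    Single i = ∃ λ w → W w × Marks w (i + k) (i + k)
    Edge   i = ∃ λ w → W w × ∃ λ a → Marks w a (suc a) × a ≤ i + k × i + k ≤ suc a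

    -- A vertex `w` covering `h x` is followed along its run of neighbours from `x` to `z`, and
    -- again from the next neighbour `y` on. A second gap would yield a second edge by `gap-edge`,
    -- so the neighbours fill one interval from `y` to `z + k`; three or more would form a sector
    -- wheel.
    single-or-edge : ∀ x → Single x ⊎ Edge x
    single-or-edge x with cover x
    ... | w , ww , w~x with search (λ i → ¬? (w ~? h i)) x (x + k)
    ... | inj₂ none = ⊥-elim (no-universal (hole x) λ {l} l<k →
            decidable-stable (w ~? h (x + l)) (none (m≤m+n x l) (+-monoʳ-< x l<k)))
    ... | inj₁ (zero , z≤n , _ , w≁0 , _) = ⊥-elim (w≁0 w~x)
    ... | inj₁ (suc z , x≤1+z , 1+z<x+k , w≁1+z , marked) with m≤n⇒m<n∨m≡n x≤1+z
    ...   | inj₂ refl = ⊥-elim (w≁1+z w~x)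
    ...   | inj₁ (s≤s x≤z) with first (λ i → w ~? h i) (<⇒≤ 1+z<x+k) (shift-mark w~x)
    ...     | y , z<y , y≤x+k , w~y , free with initial-segment w~y y≤x+k (+-monoˡ-< k 1+x<y)
      where
      1+x<y : suc x < y
      1+x<y = ≤-<-trans (s≤s x≤z) (≤∧≢⇒< z<y λ where refl → w≁1+z w~y)
    ...       | inj₁ (c , d , y≤c , d≤x+k , g′) =
                  -- The fuel merely exceeds the end of each gap. The two gaps do not overlap within
                  -- one period, so the edges found in them differ.
                  let (_ , e , wu , M , z≤e , e<y) = gap-edge (suc y) ww g (m≤n+m (suc y) z)
                      (_ , e′ , wu′ , M′ , c≤e′ , e′<d) = gap-edge (suc d) ww g′ (m≤n+m (suc d) c)
                      e<e′ = <-≤-trans (<-trans (n<1+n e) e<y) (≤-trans y≤c c≤e′)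
                      e′<e+k = <-≤-trans (<-trans (n<1+n e′) e′<d) (≤-trans d≤x+k (+-monoˡ-≤ k (≤-trans x≤z z≤e)))
                  in ⊥-elim (no-two-edges wu wu′ M M′ e<e′ e′<e+k)
      where
      g : Gap w z y
      -- Narrowness of the first gap comes from the second, which fits between `y` and `x + k`.
      g = gap (≤∧≢⇒< z<y λ where refl → w≁1+z w~y)
              (<-≤-trans (≤-trans (s≤s (s≤s y≤c)) (≤-trans (Gap.wide g′) d≤x+k)) (+-monoˡ-≤ k x≤z))
              (decidable-stable (w ~? h z) (marked x≤z ≤-refl)) w~y free
    ...       | inj₂ (z′ , _ , z′≤x+k , marked′ , none) = conclude (m≤n⇒m<n∨m≡n y≤z+k)
      where
      y≤z+k : y ≤ z + k
      y≤z+k = ≤-trans y≤x+k (+-monoˡ-≤ k x≤z)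
      z+1<y : suc z < y
      z+1<y = ≤∧≢⇒< z<y λ where refl → w≁1+z w~y
      all : ∀ {i} → y ≤ i → i ≤ z + k → w ~ h i
      -- Up to `x + k` the interval is complete because `x + k` is itself marked; beyond it the run
      -- from `x` to `z` repeats.
      all {i} y≤i i≤z+k with i ≤? x + k
      ... | yes i≤x+k = marked′ y≤i (≤-trans i≤x+k (≮⇒≥ λ z′<x+k → none z′<x+k ≤-refl (shift-mark w~x)))
      ... | no i≰x+k with m≤n⇒∃[o]m+o≡n (≤-trans (m≤n+m k x) (<⇒≤ (≰⇒> i≰x+k)))
      ...   | o , refl = subst (λ j → w ~ h j) (+-comm o k) (shift-mark
                (decidable-stable (w ~? h o) (marked x≤o (s≤s o≤z))))
        where
        o≤z : o ≤ z
        o≤z = +-cancelʳ-≤ k o z (subst (_≤ z + k) (+-comm k o) i≤z+k)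
        x≤o : x ≤ o
        x≤o = +-cancelʳ-≤ k x o (subst (x + k ≤_) (+-comm k o) (<⇒≤ (≰⇒> i≰x+k)))
      beyond : None (λ i → w ~ h i) (suc (z + k)) (y + k)
      beyond {i} z+k<i i<y+k e with m≤n⇒∃[o]m+o≡n (≤-trans (m≤n+m k (suc z)) z+k<i)
      ... | o , refl = free (+-cancelʳ-< k z o (subst (z + k <_) (+-comm k o) z+k<i))
              (+-cancelʳ-< k o y (subst (_< y + k) (+-comm k o) i<y+k))
              (unshift-mark (subst (λ j → w ~ h j) (+-comm k o) e))
      inner : ∀ {j} → j < y + k → w ~ h j → j ≤ z + k
      inner j<y+k e = ≮⇒≥ λ z+k<j → beyond z+k<j j<y+k e
      conclude : y < z + k ⊎ y ≡ z + k → Single x ⊎ Edge x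
      conclude (inj₂ y≡z+k) = inj₁ (w , ww , subst (λ a → Marks w a a) y≡x+k record
        { start = w~y ; end = w~y ; only = λ {j} y≤j j<y+k e →
            inj₁ (≤-antisym (subst (j ≤_) (≡.sym y≡z+k) (inner j<y+k e)) y≤j) })
        where
        y≡x+k : y ≡ x + k
        y≡x+k = ≤-antisym y≤x+k (subst (x + k ≤_) (≡.sym y≡z+k) (+-monoˡ-≤ k x≤z))
      conclude (inj₁ y<z+k) with m≤n⇒m<n∨m≡n y<z+k
      ... | inj₁ 1+y<z+k = ⊥-elim (ring-no-segment ww 1+y<z+k (+-monoˡ-< k z+1<y) all beyond)
      ... | inj₂ 1+y≡z+k = inj₂ (w , ww , y , record
        { start = w~y ; end = all (n≤1+n y) y<z+k ; only = only } , y≤x+k ,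
          subst (x + k ≤_) (≡.sym 1+y≡z+k) (+-monoˡ-≤ k x≤z))
        where
        only : ∀ {j} → y ≤ j → j < y + k → w ~ h j → j ≡ y ⊎ j ≡ suc y
        only {j} y≤j j<y+k e with m≤n⇒m<n∨m≡n y≤j
        ... | inj₂ y≡j = inj₁ (≡.sym y≡j)
        ... | inj₁ y<j = inj₂ (≤-antisym (subst (j ≤_) (≡.sym 1+y≡z+k) (inner j<y+k e)) y<j)

    not-both-single : ∀ {i j} → 2 + i ≤ j → suc j < i + k → Single i → ¬ Single j
    not-both-single 2+i≤j 1+j<i+k (_ , wu , M) (_ , wu′ , M′) =
      no-two-singles wu wu′ M M′ (+-monoˡ-≤ k 2+i≤j) (+-monoˡ-< k 1+j<i+k)

    -- No edge of the hole contains both of two nonadjacent vertices, so the edges at `i` and `j`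
    -- differ.
    not-both-edge : ∀ {i j} → 2 + i ≤ j → suc j < i + k → Edge i → ¬ Edge j
    not-both-edge {i} {j} 2+i≤j 1+j<i+k
        (_ , wu , a , M , a≤i+k , i+k≤1+a) (_ , wu′ , a′ , M′ , a′≤j+k , j+k≤1+a′) =
      no-two-edges wu wu′ M M′
        (≤-trans (s≤s a≤i+k) (≤-pred (≤-trans (+-monoˡ-≤ k 2+i≤j) j+k≤1+a′)))
        (≤-<-trans a′≤j+k (+-monoˡ-< k (≤-pred (≤-trans 1+j<i+k i+k≤1+a))))

    -- The reversed rules serve the hole of length five: its nonadjacent pairs form the cycle 0, 2,
    -- 4, 1, 3, whose step from 4 to 1 goes downwards.
    module _ {i j} (2+i≤j : 2 + i ≤ j) (1+j<i+k : suc j < i + k) where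

      single→edge : Single i → Edge j
      single→edge s = [ ⊥-elim ∘ not-both-single 2+i≤j 1+j<i+k s , id ]′ (single-or-edge j)

      edge→single : Edge i → Single j
      edge→single e = [ id , ⊥-elim ∘ not-both-edge 2+i≤j 1+j<i+k e ]′ (single-or-edge j)

      single←edge : Edge j → Single i
      single←edge e = [ id , (λ e′ → ⊥-elim (not-both-edge 2+i≤j 1+j<i+k e′ e)) ]′ (single-or-edge i)

      edge←single : Single j → Edge i
      edge←single s = [ (λ s′ → ⊥-elim (not-both-single 2+i≤j 1+j<i+k s′ s)) , id ]′ (single-or-edge i)

    -- Singles and edges alternate along pairs of nonadjacent vertices of the hole, whereas
    -- the complement of the hole contains an odd cycle: a triangle, or C₅ when k = 5.
    no-attachment : ⊥
    no-attachment with m≤n⇒m<n∨m≡n long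
    ... | inj₁ 5<k = [ (λ s → not-both-single 2≤4 5<k s (edge→single 4≤4 5<2+k (single→edge 2≤2 3<k s)))
                     , (λ e → not-both-edge 2≤4 5<k e (single→edge 4≤4 5<2+k (edge→single 2≤2 3<k e))) ]′
                     (single-or-edge 0)
      where
      2≤2 : 2 ≤ 2
      2≤2 = ≤-refl
      4≤4 : 4 ≤ 4
      4≤4 = ≤-refl
      2≤4 : 2 ≤ 4
      2≤4 = m≤m+n 2 2
      3<k : 3 < k
      3<k = ≤-trans (m≤m+n 4 1) long
      5<2+k : 5 < 2 + k
      5<2+k = ≤-trans 5<k (m≤n+m k 2)
    ... | inj₂ refl = [ (λ s → not-both-single 2≤3 ≤-refl s
                          (edge→single ≤-refl 4<6 (edge←single 3≤4 ≤-refl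
                            (edge→single ≤-refl 5<7 (single→edge ≤-refl 3<5 s)))))
                      , (λ e → not-both-edge 2≤3 ≤-refl e
                          (single→edge ≤-refl 4<6 (single←edge 3≤4 ≤-refl
                            (single→edge ≤-refl 5<7 (edge→single ≤-refl 3<5 e))))) ]′
                      (single-or-edge 0)
      where
      2≤3 : 2 ≤ 3
      2≤3 = n≤1+n 2
      3≤4 : 3 ≤ 4
      3≤4 = n≤1+n 3
      3<5 : 3 < 5
      3<5 = m≤m+n 4 1
      4<6 : 4 < 6
      4<6 = m≤m+n 5 1
      5<7 : 5 < 7
      5<7 = m≤m+n 6 1

-- Breadth-first levels

module Levels (G : Graph) where
  open Paths G

  private
    V : Set
    V = Fin (n G)

  PathTo : (V → Set) → V → V → Set
  PathTo Z x y = ∃ λ m → Σ (ℕ → V) λ g → Induced m g × g 0 ≡ x × g m ≡ y × (∀ {i} → i ≤ m → Z (g i))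

  suffix : ∀ i {d g} → Induced (i + d) g → Induced d (g ∘ (i +_))
  suffix i {d} {g} Q = record
    { distinct  = λ a<b b≤d → Q.distinct (+-monoʳ-< i a<b) (+-monoʳ-≤ i b≤d)
    ; edge      = λ {a} a<d → subst (λ l → g (i + a) ~ g l) (≡.sym (+-suc i a)) (Q.edge (+-monoʳ-< i a<d))
    ; chordless = λ {a} {b} 1+a<b b≤d →
        Q.chordless (subst (_< i + b) (+-suc i a) (+-monoʳ-< i 1+a<b)) (+-monoʳ-≤ i b≤d) }
    where module Q = Induced Q

  -- The new vertex may lie on the path or have several neighbours there; cutting the path at its
  -- last vertex equal or adjacent to `x` keeps it induced. Walks thus become induced paths inside
  -- `Z` without an appeal to shortest paths.
  extend : ∀ {Z x x′ y} → Z x → x ~ x′ → PathTo Z x′ y → PathTo Z x y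
  extend {Z} {x} zx x~x′ (m , g , Q , refl , refl , zg)
    with last (λ i → (x ≟ᶠ g i) ⊎-dec (x ~? g i)) {b = m} z≤n (inj₂ x~x′)
  ... | i , _ , i≤m , x-gi , none with m≤n⇒∃[o]m+o≡n i≤m
  ...   | d , refl = attach x-gi
    where
    attach : x ≡ g i ⊎ x ~ g i → PathTo Z x (g (i + d))
    attach (inj₁ x≡gi) = d , g ∘ (i +_) , suffix i Q ,
      trans (cong g (+-identityʳ i)) (≡.sym x≡gi) , refl , zg ∘ +-monoʳ-≤ i
    attach (inj₂ x~gi) = suc d , x ◂ g ∘ (i +_) ,
      induced-cons (suffix i Q) (subst (λ l → x ~ g l) (≡.sym (+-identityʳ i)) x~gi) fresh
        (λ 0<j j≤d e → none (m<m+n i 0<j) (s≤s (+-monoʳ-≤ i j≤d)) (inj₂ e)) ,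
      refl , refl , within
      where
      fresh : ∀ {j} → j ≤ d → x ≢ g (i + j)
      fresh {zero}  _   e = ~⇒≢ x~gi (trans e (cong g (+-identityʳ i)))
      fresh {suc j} j<d e = none (m<m+n i (s≤s z≤n)) (s≤s (+-monoʳ-≤ i j<d)) (inj₁ e)
      within : ∀ {j} → j ≤ suc d → Z ((x ◂ g ∘ (i +_)) j)
      within {zero}  _         = zx
      within {suc j} (s≤s j≤d) = zg (+-monoʳ-≤ i j≤d)

  Within : ℕ → V → V → Set
  Within zero    r v = v ≡ r
  Within (suc m) r v = Within m r v ⊎ ∃ λ w → v ~ w × Within m r w

  within? : ∀ m r v → Dec (Within m r v)
  within? zero    r v = v ≟ᶠ r
  within? (suc m) r v = within? m r v ⊎-dec any? λ w → (v ~? w) ×-dec within? m r w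

  within-self : ∀ m v → Within m v v
  within-self zero    v = refl
  within-self (suc m) v = inj₁ (within-self m v)

  within-mono : ∀ {m m′ r v} → m ≤ m′ → Within m r v → Within m′ r v
  within-mono {zero}  {m′}     z≤n       refl                 = within-self m′ _
  within-mono {suc m} {suc m′} (s≤s m≤m′) (inj₁ p)            = inj₁ (within-mono m≤m′ p)
  within-mono {suc m} {suc m′} (s≤s m≤m′) (inj₂ (w , v~w , p)) = inj₂ (w , v~w , within-mono m≤m′ p)

  within→path : ∀ m {r v} → Within m r v → PathTo (λ _ → ⊤) v r
  within→path zero {r} refl                = 0 , (λ _ → r) , induced-point , refl , refl , _
  within→path (suc m) (inj₁ p)             = within→path m p
  within→path (suc m) (inj₂ (w , v~w , p)) = extend tt v~w (within→path m p)

  walk→within : ∀ m (g : ℕ → V) → (∀ {i} → i < m → g i ~ g (suc i)) → Within m (g m) (g 0)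
  walk→within zero    g edge = refl
  walk→within (suc m) g edge = inj₂ (g 1 , edge (s≤s z≤n) , walk→within m (g ∘ suc) (edge ∘ s≤s))

  induced-short : ∀ {m g} → Induced m g → m < n G
  induced-short {m} {g} Q = injective⇒≤ {f = g ∘ toℕ} inj
    where
    inj : ∀ {i j : Fin (suc m)} → g (toℕ i) ≡ g (toℕ j) → i ≡ j
    inj {i} {j} e with <-cmp (toℕ i) (toℕ j)
    ... | tri< i<j _ _ = ⊥-elim (Induced.distinct Q i<j (≤-pred (toℕ<n j)) e)
    ... | tri≈ _ i≡j _ = toℕ-injective i≡j
    ... | tri> _ _ j<i = ⊥-elim (Induced.distinct Q j<i (≤-pred (toℕ<n i)) (≡.sym e))

  Reach : V → V → Set
  Reach = Within (n G)

  -- A walk shortens to an induced path, which has fewer than `n G` edges, so bounded walks already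
  -- decide reachability.
  reach : ∀ m {r v} → Within m r v → Reach r v
  reach m p with within→path m p
  ... | l , g , Q , refl , refl , _ =
    within-mono (<⇒≤ (induced-short Q)) (walk→within l g (Induced.edge Q))

  private
    rootOf : ∀ v → ∃ λ r → Reach r v × (∀ r′ → toℕ r′ < toℕ r → ¬ Reach r′ v)
    rootOf v = first-min (λ r → within? (n G) r v) (v , within-self (n G) v)

  -- The vertex of least index in the component, a canonical choice that gives adjacent vertices
  -- equal roots.
  root : V → V
  root v = proj₁ (rootOf v)

  private
    root-≤ : ∀ {v w} → v ~ w → toℕ (root w) ≤ toℕ (root v)
    root-≤ {v} {w} v~w = ≮⇒≥ λ lt → proj₂ (proj₂ (rootOf w)) (root v) lt
      (reach (suc (n G)) (inj₂ (v , ~-sym v~w , proj₁ (proj₂ (rootOf v)))))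

    levelOf : ∀ v → ∃ λ i → 0 ≤ i × i ≤ n G × Within i (root v) v × None (λ i → Within i (root v) v) 0 i
    levelOf v = first (λ i → within? i (root v) v) z≤n (proj₁ (proj₂ (rootOf v)))

  root-cong : ∀ {v w} → v ~ w → root v ≡ root w
  root-cong v~w = toℕ-injective (≤-antisym (root-≤ (~-sym v~w)) (root-≤ v~w))

  level : V → ℕ
  level v = proj₁ (levelOf v)

  within-level : ∀ v → Within (level v) (root v) v
  within-level v = proj₁ (proj₂ (proj₂ (proj₂ (levelOf v))))

  level-≤ : ∀ {m} v → Within m (root v) v → level v ≤ m
  level-≤ v p = ≮⇒≥ λ lt → proj₂ (proj₂ (proj₂ (proj₂ (levelOf v)))) z≤n lt p

  level-adjacent : ∀ {v w} → v ~ w → level w ≤ suc (level v)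
  level-adjacent {v} {w} v~w = level-≤ w (inj₂ (v , ~-sym v~w ,
    subst (λ r → Within (level v) r v) (root-cong v~w) (within-level v)))

  parent : ∀ {v d} → level v ≡ suc d → ∃ λ w → v ~ w × level w ≡ d
  parent {v} {d} e with subst (λ l → Within l (root v) v) e (within-level v)
  ... | inj₁ p = ⊥-elim (<-irrefl refl (≤-trans (≤-reflexive (≡.sym e)) (level-≤ v p)))
  ... | inj₂ (w , v~w , p) = w , v~w , ≤-antisym
    (level-≤ w (subst (λ r → Within d r w) (root-cong v~w) p))
    (≤-pred (≤-trans (≤-reflexive (≡.sym e)) (level-adjacent (~-sym v~w))))

  level-zero : ∀ {v} → level v ≡ 0 → v ≡ root v
  level-zero {v} e = subst (λ l → Within l (root v) v) e (within-level v)

  -- `climb` follows parents from `w` to the root and `descend` those from `u`, each step being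
  -- shortcut by `extend`. All vertices met on the way, apart from `u` and `w`, are proper ancestors
  -- of one of them.
  path-through-lower : ∀ {u w} → level u ≡ level w → root u ≡ root w →
                       PathTo (λ v → v ≡ u ⊎ v ≡ w ⊎ level v < level u) u w
  path-through-lower {u} {w} lu≡lw ru≡rw =
    descend (level u) refl ≤-refl (inj₁ refl) (subst (λ r → PathTo Z r w) (≡.sym ru≡rw)
      (climb (level u) (≡.sym lu≡lw) ≤-refl
        (0 , (λ _ → w) , induced-point , refl , refl , λ _ → inj₂ (inj₁ refl))))
    where
    Z : V → Set
    Z v = v ≡ u ⊎ v ≡ w ⊎ level v < level u
    lower : ∀ {v e} → level v ≡ e → suc e ≤ level u → Z v
    lower refl lt = inj₂ (inj₂ lt)
    climb : ∀ e {a} → level a ≡ e → e ≤ level u → PathTo Z a w → PathTo Z (root a) w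
    climb zero    la≡0 _   P = subst (λ r → PathTo Z r w) (level-zero la≡0) P
    climb (suc e) {a} la≡1+e e<d P with parent la≡1+e
    ... | b , a~b , lb≡e = subst (λ r → PathTo Z r w) (≡.sym (root-cong a~b))
            (climb e lb≡e (<⇒≤ e<d) (extend (lower lb≡e e<d) (~-sym a~b) P))
    descend : ∀ e {a} → level a ≡ e → e ≤ level u → Z a → PathTo Z (root a) w → PathTo Z a w
    descend zero    la≡0 _ _ P = subst (λ r → PathTo Z r w) (≡.sym (level-zero la≡0)) P
    descend (suc e) la≡1+e e<d za P with parent la≡1+e
    ... | b , a~b , lb≡e = extend za a~b
            (descend e lb≡e (<⇒≤ e<d) (lower lb≡e e<d) (subst (λ r → PathTo Z r w) (root-cong a~b) P))

-- From levels to attachments and the chordal cover.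

module _ (G : Graph) (noEven : ¬ HasEvenHole G) (noSector : ¬ HasSectorWheel G) where
  open Paths G
  open Levels G
  open Core G noEven noSector

  private
    V : Set
    V = Fin (n G)

  unroll : ∀ {k} .{{_ : NonZero k}} → (Fin k → V) → ℕ → V
  unroll {k} v i = v (i mod k)

  unroll-ring : ∀ {k} .{{_ : NonZero k}} {v : Fin k → V} → IsHole G k v → Ring k (unroll v)
  unroll-ring {k} {v} H@(4≤k , inj , adj→cyc , cyc→adj) = record
    { long      = ≤∧≢⇒< 4≤k (λ where refl → noEven (4 , v , H , even-ss (even-ss even-zero)))
    ; odd       = odd
    ; period    = λ i → cong v (toℕ-injective (trans (toℕ-mod (i + k) k)
                    (trans ([m+n]%n≡m%n i k) (≡.sym (toℕ-mod i k)))))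
    ; distinct  = distinct
    ; edge      = λ i → cyc→adj _ _ (≡.subst₂ (Cyc k) (≡.sym (toℕ-mod i k)) (≡.sym (toℕ-mod (suc i) k)) (next i))
    ; chordless = chordless }
    where
    Cyc : ℕ → ℕ → ℕ → Set
    Cyc k i j = suc i ≡ j ⊎ suc j ≡ i ⊎ (i ≡ 0 × suc j ≡ k) ⊎ (j ≡ 0 × suc i ≡ k)
    odd : parity k ≡ 1ℙ
    odd with parity k in e
    ... | 0ℙ = ⊥-elim (noEven (k , v , H , parity-even k e))
    ... | 1ℙ = refl
    1<k : 1 < k
    1<k = ≤-trans (m≤m+n 2 2) 4≤k
    next : ∀ i → Cyc k (i % k) (suc i % k)
    next i with %-step i 1<k
    ... | inj₁ (_ , e) = inj₁ (trans (+-comm 1 (i % k)) (trans (≡.sym e) (cong (_% k) (+-comm i 1))))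
    ... | inj₂ (s , k+s≡r+1 , s<r , e) = inj₂ (inj₂ (inj₂
            (trans (cong (_% k) (+-comm 1 i)) (trans e s≡0) , 1+r≡k)))
      where
      k+s≡1+r : k + s ≡ suc (i % k)
      k+s≡1+r = trans k+s≡r+1 (+-comm (i % k) 1)
      s≡0 : s ≡ 0
      s≡0 = n≤0⇒n≡0 (+-cancelˡ-≤ k s 0 (subst (k + s ≤_) (≡.sym (+-identityʳ k))
        (subst (_≤ k) (≡.sym k+s≡1+r) (m%n<n i k))))
      1+r≡k : suc (i % k) ≡ k
      1+r≡k = trans (≡.sym k+s≡1+r) (trans (cong (k +_) s≡0) (+-identityʳ k))
    distinct : ∀ {i j} → i < j → j < i + k → unroll v i ≢ unroll v j
    distinct {i} i<j j<i+k e with m≤n⇒∃[o]m+o≡n (<⇒≤ i<j)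
    ... | d , refl with trans (≡.sym (toℕ-mod i k)) (trans (cong toℕ (inj e)) (toℕ-mod (i + d) k))
                      | %-step i (+-cancelˡ-< i d k j<i+k)
    ...   | r≡r′ | inj₁ (_ , r′≡r+d) = <-irrefl (trans r≡r′ r′≡r+d)
              (m<m+n (i % k) (+-cancelˡ-< i 0 d (subst (_< i + d) (≡.sym (+-identityʳ i)) i<j)))
    ...   | r≡r′ | inj₂ (s , _ , s<r , r′≡s) = <-irrefl (≡.sym (trans r≡r′ r′≡s)) s<r
    chordless : ∀ {i j} → suc i < j → suc j < i + k → ¬ unroll v i ~ unroll v j
    chordless {i} 1+i<j 1+j<i+k e with m≤n⇒∃[o]m+o≡n (≤-trans (m≤n+m i 2) 1+i<j)
    ... | d , refl = impossible (%-step i d<k)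
            (≡.subst₂ (Cyc k) (toℕ-mod i k) (toℕ-mod (i + d) k) (adj→cyc _ _ e))
      where
      1<d : 1 < d
      1<d = +-cancelˡ-< i 1 d (subst (_< i + d) (+-comm 1 i) 1+i<j)
      1+d<k : suc d < k
      1+d<k = +-cancelˡ-< i (suc d) k (subst (_< i + k) (≡.sym (+-suc i d)) 1+j<i+k)
      d<k : d < k
      d<k = <-trans (n<1+n d) 1+d<k
      r : ℕ
      r = i % k
      impossible : (r + d < k × (i + d) % k ≡ r + d) ⊎ (∃ λ s → k + s ≡ r + d × s < r × (i + d) % k ≡ s) →
                   ¬ Cyc k r ((i + d) % k)
      impossible (inj₁ (r+d<k , e)) c rewrite e with c
      ... | inj₁ 1+r≡r+d = <-irrefl (+-cancelˡ-≡ r 1 d (trans (+-comm r 1) 1+r≡r+d)) 1<d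
      ... | inj₂ (inj₁ 1+r+d≡r) = <⇒≱ (s≤s (m≤m+n r d)) (≤-reflexive 1+r+d≡r)
      ... | inj₂ (inj₂ (inj₁ (r≡0 , 1+r+d≡k))) =
              <-irrefl (trans (cong (λ q → suc (q + d)) (≡.sym r≡0)) 1+r+d≡k) 1+d<k
      ... | inj₂ (inj₂ (inj₂ (r+d≡0 , _))) = <⇒≱ 1<d (≤-trans (≤-reflexive (m+n≡0⇒n≡0 r r+d≡0)) z≤n)
      impossible (inj₂ (s , k+s≡r+d , s<r , e)) c rewrite e with c
      ... | inj₁ 1+r≡s = <-irrefl (≡.sym 1+r≡s) (<-trans s<r (n<1+n r))
      ... | inj₂ (inj₁ 1+s≡r) = <-irrefl (+-cancelˡ-≡ s (suc d) k (trans (+-suc s d)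
              (trans (cong (_+ d) 1+s≡r) (trans (≡.sym k+s≡r+d) (+-comm k s))))) 1+d<k
      ... | inj₂ (inj₂ (inj₁ (r≡0 , _))) = <⇒≱ s<r (≤-trans (≤-reflexive r≡0) z≤n)
      ... | inj₂ (inj₂ (inj₂ (s≡0 , 1+r≡k))) = <-irrefl (+-cancelˡ-≡ r 1 d (trans (+-comm r 1)
              (trans 1+r≡k (trans (≡.sym (+-identityʳ k)) (trans (cong (k +_) (≡.sym s≡0)) k+s≡r+d))))) 1<d

  -- Parents give the cover. Interior vertices of a link lie at least two levels below the hole, so
  -- they are neither on it nor adjacent to it.
  level-attachment : ∀ {k h d} → Ring k h → (∀ i → level (h i) ≡ suc d) →
                     Attachment k h (λ w → level w ≡ d × root w ≡ root (h 0))
  level-attachment {k} {h} {d} R lh = record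
    { ring    = R
    ; outside = λ (lw≡d , _) i e → 1+n≢n (trans (≡.sym (lh i)) (trans (cong level e) lw≡d))
    ; cover   = λ i → let (w , hi~w , lw≡d) = parent (lh i)
                      in w , (lw≡d , trans (≡.sym (root-cong hi~w)) (rh i)) , ~-sym hi~w
    ; link    = link }
    where
    rh : ∀ i → root (h i) ≡ root (h 0)
    rh zero    = refl
    rh (suc i) = trans (≡.sym (root-cong (Ring.edge R i))) (rh i)
    link : ∀ {u w} → level u ≡ d × root u ≡ root (h 0) → level w ≡ d × root w ≡ root (h 0) →
           u ≢ w → ∃ λ p → Link h p u w
    link {u} {w} (lu≡d , ru) (lw≡d , rw) u≢w
      with path-through-lower {u} {w} (trans lu≡d (≡.sym lw≡d)) (trans ru (≡.sym rw))
    ... | p , g , Q , refl , refl , zg = p , g , Q , refl , refl , away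
      where
      lower : ∀ {i} → 0 < i → i < p → level (g i) < d
      lower 0<i i<p with zg (<⇒≤ i<p)
      ... | inj₁ e         = ⊥-elim (Induced.distinct Q 0<i (<⇒≤ i<p) (≡.sym e))
      ... | inj₂ (inj₁ e)  = ⊥-elim (Induced.distinct Q i<p ≤-refl e)
      ... | inj₂ (inj₂ lt) = subst (_ <_) lu≡d lt
      away : ∀ {i} → 0 < i → i < p → ∀ j → h j ≢ g i × ¬ h j ~ g i
      away 0<i i<p j =
        (λ e → <⇒≱ (lower 0<i i<p) (≤-trans (n≤1+n d) (≤-reflexive (trans (≡.sym (lh j)) (cong level e))))) ,
        (λ e → <⇒≱ (lower 0<i i<p) (≤-pred (≤-trans (≤-reflexive (≡.sym (lh j))) (level-adjacent (~-sym e)))))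

  level-constant : ∀ {v w} → v ~ w → parity (level v) ≡ parity (level w) → level v ≡ level w
  level-constant {v} {w} v~w e with <-cmp (level v) (level w)
  ... | tri≈ _ lv≡lw _ = lv≡lw
  ... | tri< lv<lw _ _ = ⊥-elim (p≢p⁻¹ (parity (level v)) (trans e
          (trans (cong parity (≤-antisym (level-adjacent v~w) lv<lw)) (parity-suc (level v)))))
  ... | tri> _ _ lw<lv = ⊥-elim (p≢p⁻¹ (parity (level w)) (trans (≡.sym e)
          (trans (cong parity (≤-antisym (level-adjacent (~-sym v~w)) lw<lv)) (parity-suc (level w)))))

  level-parity-chordal : ∀ {k v} q → (∀ i → parity (level (v i)) ≡ q) → ¬ IsHole G k v
  level-parity-chordal {suc k} {v} q ph H = absurd (level (h 0)) refl
    where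
    h : ℕ → V
    h = unroll v
    R : Ring (suc k) h
    R = unroll-ring H
    same : ∀ i → level (h i) ≡ level (h 0)
    same zero    = refl
    same (suc i) = trans (≡.sym (level-constant (Ring.edge R i) (trans (ph _) (≡.sym (ph _))))) (same i)
    absurd : ∀ d → level (h 0) ≡ d → ⊥
    -- A component has only its root on level 0, whereas `h 0` and `h 1` are adjacent and hence
    -- distinct.
    absurd zero    e = ~⇒≢ (Ring.edge R 0) (trans (level-zero e)
      (trans (root-cong (Ring.edge R 0)) (≡.sym (level-zero (trans (same 1) e)))))
    absurd (suc d) e = Attached.no-attachment (level-attachment R λ i → trans (same i) e)

theorem1p1 : (G : Graph) → ¬ HasEvenHole G → ¬ HasSectorWheel G → HasChordalCover G
theorem1p1 G noEven noSector = class 0ℙ , class 1ℙ , covers , chordal 0ℙ , chordal 1ℙ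
  where
  open Levels G
  class : Parity → Subset (n G)
  class q = tabulate λ v → does (parity (level v) ≟ q)
  class-∈ : ∀ {q} v → parity (level v) ≡ q → v ∈ class q
  class-∈ {q} v e = lookup⇒[]= v (class q)
    (trans (lookup∘tabulate _ v) (dec-true (parity (level v) ≟ q) e))
  ∈-class : ∀ {q} v → v ∈ class q → parity (level v) ≡ q
  ∈-class {q} v v∈ with parity (level v) ≟ q | trans (≡.sym (lookup∘tabulate _ v)) ([]=⇒lookup v∈)
  ... | yes e | _  = e
  ... | no  _ | ()
  covers : ∀ v → v ∈ class 0ℙ ⊎ v ∈ class 1ℙ
  covers v with parity (level v) in e
  ... | 0ℙ = inj₁ (class-∈ v e)
  ... | 1ℙ = inj₂ (class-∈ v e)
  chordal : ∀ q → InducedChordal G (class q)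
  chordal q k v v∈ = level-parity-chordal G noEven noSector q (λ i → ∈-class (v i) (v∈ i))
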